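{- There is a $(1-1/e-\epsilon)$-approximation algorithm for maximizing a monotone DR-submodular function subject to a cardinality constraint $B$ with running time $O\left(\frac{m\log(m/\epsilon)}{\epsilon}\right)$, where $m=\frac{n}{\epsilon}+\sum_{i\in E}\log B_i$. That is, there is an algorithm that, given $\epsilon\in(0,1)$, a finite set $E$ with $|E|=n$, positive integers $B$ and $B_i$ ($i\in E$), and a monotone DR-submodular function $f:\mathbb{Z}_+^E\to\mathbb{R}_+$, runs within this time bound and outputs a vector $\mathbf{x}\in\prod_{i\in E}\{0,1,\ldots,B_i\}$ with $\sum_{i\in E}x_i\le B$ whose value $f(\mathbf{x})$ is at least $(1-1/e-\epsilon)\max\{f(\mathbf{z}):\mathbf{z}\in\prod_{i\in E}\{0,1,\ldots,B_i\},\ \sum_{i\in E}z_i\le B\}$.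
   Context: $\mathbb{Z}_+$ and $\mathbb{R}_+$ denote the nonnegative integers and nonnegative reals. For $i\in E$, $\chi_i\in\{0,1\}^E$ is the vector with $1$ in coordinate $i$ and $0$ elsewhere; inequalities between vectors are coordinatewise. A function $f:\mathbb{Z}_+^E\to\mathbb{R}_+$ is DR-submodular if $f(\mathbf{x}+\chi_i)-f(\mathbf{x})\ge f(\mathbf{y}+\chi_i)-f(\mathbf{y})$ for all $\mathbf{x}\le\mathbf{y}$ in $\mathbb{Z}_+^E$ and all $i\in E$; it is monotone if $f(\mathbf{x})\le f(\mathbf{y})$ whenever $\mathbf{x}\le\mathbf{y}$. The function $f$ is accessed through a value oracle; running time counts oracle calls and elementary arithmetic operations at unit cost. -}

module Defs where

open import Algebra.Bundles using (CommutativeRing; Semiring)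
import Algebra.Definitions.RawSemiring as RawSemiringDefinitions
open import Algebra.Structures using (IsCommutativeRing)
open import Data.Bool.Base using (Bool; true; false; if_then_else_; not; _∧_)
open import Data.Fin.Base using (Fin; toℕ)
open import Data.Nat.Base as ℕ using (ℕ; zero; suc; _≤ᵇ_; _≡ᵇ_)
open import Data.Product.Base using (Σ-syntax; ∃-syntax; _×_)
open import Data.Vec.Base as Vec using (Vec; []; _∷_; replicate; zipWith; tabulate; _[_]≔_)
open import Data.Vec.Relation.Binary.Pointwise.Inductive using (Pointwise)
open import Level using (0ℓ)
open import Relation.Binary.PropositionalEquality using (_≡_; _≢_)
open import Relation.Binary.Structures using (IsDecTotalOrder)
open import Relation.Nullary.Decidable.Core using (does)

------------------------------------------------------------------------
-- The real numbers, axiomatised as a complete ordered field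

record RealNumbers : Set₁ where
  infixl 6 _+_
  infixl 7 _*_
  infix  8 -_
  infix  9 _⁻¹
  infix  4 _≤_ _<_
  field
    Carrier           : Set
    _+_ _*_           : Carrier → Carrier → Carrier
    -_ _⁻¹            : Carrier → Carrier
    0# 1#             : Carrier
    _≤_               : Carrier → Carrier → Set
    isCommutativeRing : IsCommutativeRing _≡_ _+_ _*_ -_ 0# 1#
    0≢1               : 0# ≢ 1#
    *-inverseʳ        : ∀ x → x ≢ 0# → x * x ⁻¹ ≡ 1#
    -- Decidability of the order is what a real RAM's branching relies on.
    isDecTotalOrder   : IsDecTotalOrder _≡_ _≤_
    +-monoˡ-≤         : ∀ z {x y} → x ≤ y → x + z ≤ y + z
    *-nonNeg          : ∀ {x y} → 0# ≤ x → 0# ≤ y → 0# ≤ x * y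

  commutativeRing : CommutativeRing 0ℓ 0ℓ
  commutativeRing = record { isCommutativeRing = isCommutativeRing }

  open CommutativeRing commutativeRing public using (_-_; semiring)
  open IsDecTotalOrder isDecTotalOrder public using (_≤?_)
  open RawSemiringDefinitions (Semiring.rawSemiring semiring) public using (_^_)
    renaming (_×_ to _·_)

  infixl 7 _÷_

  _<_ : Carrier → Carrier → Set
  x < y = x ≤ y × x ≢ y

  _÷_ : Carrier → Carrier → Carrier
  x ÷ y = x * y ⁻¹

  fromℕ : ℕ → Carrier
  fromℕ k = k · 1#

  UpperBound : (Carrier → Set) → Carrier → Set
  UpperBound P b = ∀ x → P x → x ≤ b

  IsSupremum : (Carrier → Set) → Carrier → Set
  IsSupremum P s = UpperBound P s × (∀ b → UpperBound P b → s ≤ b)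

  field
    -- Total for convenience: sup P is arbitrary if P is empty or unbounded.
    sup         : (Carrier → Set) → Carrier
    sup-lub     : ∀ P → (∃[ x ] P x) → (∃[ b ] UpperBound P b) →
                  IsSupremum P (sup P)
    -- Follows from completeness classically, but not constructively.
    archimedean : ∀ x → ∃[ k ] x ≤ fromℕ k

  2# : Carrier
  2# = 1# + 1#

  -- The limit of the increasing sequence (1 + 1/(k+1))^(k+1).
  e : Carrier
  e = sup λ y → ∃[ k ] y ≡ (1# + 1# ÷ fromℕ (suc k)) ^ suc k

  -- The supremum of the rationals (p - r)/(q+1) with 2^((p - r)/(q+1)) ≤ x;
  -- meaningful for x > 0.
  log₂ : Carrier → Carrier
  log₂ x = sup λ y → ∃[ p ] ∃[ r ] ∃[ q ]
    (2# ^ p ≤ 2# ^ r * x ^ suc q) × (y ≡ (fromℕ p - fromℕ r) ÷ fromℕ (suc q))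

  sum : ∀ {n} → Vec Carrier n → Carrier
  sum = Vec.foldr′ _+_ 0#

------------------------------------------------------------------------
-- The integer lattice, the ground set being Fin n

χ : ∀ {n} → Fin n → Vec ℕ n
χ {n} i = replicate n 0 [ i ]≔ 1

infixl 6 _⊕_
_⊕_ : ∀ {n} → Vec ℕ n → Vec ℕ n → Vec ℕ n
_⊕_ = zipWith ℕ._+_

infix 4 _≼_
_≼_ : ∀ {n} → Vec ℕ n → Vec ℕ n → Set
_≼_ = Pointwise ℕ._≤_

Feasible : ∀ {n} → ℕ → Vec ℕ n → Vec ℕ n → Set
Feasible B Bs x = x ≼ Bs × Vec.sum x ℕ.≤ B

module _ (ℝ : RealNumbers) where
  open RealNumbers ℝ

  NonNegative : ∀ {n} → (Vec ℕ n → Carrier) → Set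
  NonNegative f = ∀ x → 0# ≤ f x

  Monotone : ∀ {n} → (Vec ℕ n → Carrier) → Set
  Monotone f = ∀ x y → x ≼ y → f x ≤ f y

  DRSubmodular : ∀ {n} → (Vec ℕ n → Carrier) → Set
  DRSubmodular f = ∀ x y → x ≼ y → ∀ i →
    f (y ⊕ χ i) - f y ≤ f (x ⊕ χ i) - f x

  IsMaximum : ∀ {n} → (Vec ℕ n → Carrier) → (Vec ℕ n → Set) → Carrier → Set
  IsMaximum f P M = (∃[ z ] P z × f z ≡ M) × (∀ z → P z → f z ≤ M)

  size : ∀ {n} → Carrier → Vec ℕ n → Carrier
  size {n} ε Bs = fromℕ n ÷ ε + sum (Vec.map (λ b → log₂ (fromℕ b)) Bs)

  timeBound : Carrier → Carrier → Carrier
  timeBound m ε = (m * log₂ (m ÷ ε)) ÷ ε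

------------------------------------------------------------------------
-- Programs: a structured real RAM with a value oracle.  Programs are finite
-- syntax with no real constants.  Registers and arrays are named by ℕ.

data NatExp : Set where
  lit      : ℕ → NatExp
  reg      : ℕ → NatExp
  _⟨_⟩     : ℕ → NatExp → NatExp
  _∔_ _∸_ _∗_ : NatExp → NatExp → NatExp

data RealExp : Set where
  reg      : ℕ → RealExp
  _⟨_⟩     : ℕ → NatExp → RealExp
  real     : NatExp → RealExp
  _∔_ _−_ _∗_ _∕_ : RealExp → RealExp → RealExp

data BoolExp : Set where
  _≤ⁿ_ : NatExp → NatExp → BoolExp
  _≤ʳ_ : RealExp → RealExp → BoolExp
  ¬ᵇ_  : BoolExp → BoolExp
  _&_  : BoolExp → BoolExp → BoolExp

data Program : Set where
  skip       : Program
  _≔ⁿ_       : ℕ → NatExp → Program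
  _≔ʳ_       : ℕ → RealExp → Program
  _⟨_⟩≔ⁿ_    : ℕ → NatExp → NatExp → Program
  _⟨_⟩≔ʳ_    : ℕ → NatExp → RealExp → Program
  -- query r a: real register r receives f evaluated at the first n cells
  -- of natural-number array a.
  query      : ℕ → ℕ → Program
  _⨾_        : Program → Program → Program
  IF_THEN_ELSE_ : BoolExp → Program → Program → Program
  WHILE_DO_     : BoolExp → Program → Program

infix  8 _⟨_⟩
infixl 7 _∗_ _∕_
infixl 6 _∔_ _∸_ _−_
infix  5 _≤ⁿ_ _≤ʳ_ ¬ᵇ_
infixr 4 _&_
infix  4 _≔ⁿ_ _≔ʳ_ _⟨_⟩≔ⁿ_ _⟨_⟩≔ʳ_
infix  3 IF_THEN_ELSE_ WHILE_DO_
infixr 2 _⨾_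

costⁿ : NatExp → ℕ
costⁿ (lit _)  = 1
costⁿ (reg _)  = 1
costⁿ (_ ⟨ i ⟩) = suc (costⁿ i)
costⁿ (a ∔ b)  = suc (costⁿ a ℕ.+ costⁿ b)
costⁿ (a ∸ b)  = suc (costⁿ a ℕ.+ costⁿ b)
costⁿ (a ∗ b)  = suc (costⁿ a ℕ.+ costⁿ b)

costʳ : RealExp → ℕ
costʳ (reg _)  = 1
costʳ (_ ⟨ i ⟩) = suc (costⁿ i)
costʳ (real a) = suc (costⁿ a)
costʳ (a ∔ b)  = suc (costʳ a ℕ.+ costʳ b)
costʳ (a − b)  = suc (costʳ a ℕ.+ costʳ b)
costʳ (a ∗ b)  = suc (costʳ a ℕ.+ costʳ b)
costʳ (a ∕ b)  = suc (costʳ a ℕ.+ costʳ b)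

costᵇ : BoolExp → ℕ
costᵇ (a ≤ⁿ b) = suc (costⁿ a ℕ.+ costⁿ b)
costᵇ (a ≤ʳ b) = suc (costʳ a ℕ.+ costʳ b)
costᵇ (¬ᵇ b)   = suc (costᵇ b)
costᵇ (b & c)  = suc (costᵇ b ℕ.+ costᵇ c)

update : {A : Set} → (ℕ → A) → ℕ → A → ℕ → A
update g k v j = if j ≡ᵇ k then v else g j

module Semantics (ℝ : RealNumbers) where
  open RealNumbers ℝ

  record State : Set where
    constructor mkState
    field
      natReg  : ℕ → ℕ
      realReg : ℕ → Carrier
      natArr  : ℕ → ℕ → ℕ
      realArr : ℕ → ℕ → Carrier

  open State public

  evalⁿ : NatExp → State → ℕ
  evalⁿ (lit k)  s = k
  evalⁿ (reg x)  s = natReg s x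
  evalⁿ (a ⟨ i ⟩) s = natArr s a (evalⁿ i s)
  evalⁿ (a ∔ b)  s = evalⁿ a s ℕ.+ evalⁿ b s
  evalⁿ (a ∸ b)  s = evalⁿ a s ℕ.∸ evalⁿ b s
  evalⁿ (a ∗ b)  s = evalⁿ a s ℕ.* evalⁿ b s

  evalʳ : RealExp → State → Carrier
  evalʳ (reg x)  s = realReg s x
  evalʳ (a ⟨ i ⟩) s = realArr s a (evalⁿ i s)
  evalʳ (real a) s = fromℕ (evalⁿ a s)
  evalʳ (a ∔ b)  s = evalʳ a s + evalʳ b s
  evalʳ (a − b)  s = evalʳ a s - evalʳ b s
  evalʳ (a ∗ b)  s = evalʳ a s * evalʳ b s
  evalʳ (a ∕ b)  s = evalʳ a s ÷ evalʳ b s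

  evalᵇ : BoolExp → State → Bool
  evalᵇ (a ≤ⁿ b) s = evalⁿ a s ≤ᵇ evalⁿ b s
  evalᵇ (a ≤ʳ b) s = does (evalʳ a s ≤? evalʳ b s)
  evalᵇ (¬ᵇ b)   s = not (evalᵇ b s)
  evalᵇ (b & c)  s = evalᵇ b s ∧ evalᵇ c s

  setNatReg : ℕ → ℕ → State → State
  setNatReg x v s = record s { natReg = update (natReg s) x v }

  setRealReg : ℕ → Carrier → State → State
  setRealReg x v s = record s { realReg = update (realReg s) x v }

  setNatArr : ℕ → ℕ → ℕ → State → State
  setNatArr a i v s =
    record s { natArr = update (natArr s) a (update (natArr s a) i v) }

  setRealArr : ℕ → ℕ → Carrier → State → State
  setRealArr a i v s =
    record s { realArr = update (realArr s) a (update (realArr s a) i v) }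

  readVec : (n : ℕ) → ℕ → State → Vec ℕ n
  readVec n a s = tabulate λ i → natArr s a (toℕ i)

  -- Exec f c s s′ t: with oracle f, the program c started in state s
  -- terminates in state s′ after t unit-cost steps.
  data Exec {n : ℕ} (f : Vec ℕ n → Carrier) : Program → State → State → ℕ → Set where
    skip : ∀ {s} → Exec f skip s s 1
    assignⁿ : ∀ {x a s} →
      Exec f (x ≔ⁿ a) s (setNatReg x (evalⁿ a s) s) (suc (costⁿ a))
    assignʳ : ∀ {x a s} →
      Exec f (x ≔ʳ a) s (setRealReg x (evalʳ a s) s) (suc (costʳ a))
    storeⁿ : ∀ {a i b s} →
      Exec f (a ⟨ i ⟩≔ⁿ b) s (setNatArr a (evalⁿ i s) (evalⁿ b s) s)
        (suc (costⁿ i ℕ.+ costⁿ b))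
    storeʳ : ∀ {a i b s} →
      Exec f (a ⟨ i ⟩≔ʳ b) s (setRealArr a (evalⁿ i s) (evalʳ b s) s)
        (suc (costⁿ i ℕ.+ costʳ b))
    query : ∀ {x a s} →
      Exec f (query x a) s (setRealReg x (f (readVec n a s)) s) 1
    seq : ∀ {c d s s′ s″ t u} →
      Exec f c s s′ t → Exec f d s′ s″ u → Exec f (c ⨾ d) s s″ (t ℕ.+ u)
    if-true : ∀ {b c d s s′ t} → evalᵇ b s ≡ true →
      Exec f c s s′ t → Exec f (IF b THEN c ELSE d) s s′ (suc (costᵇ b ℕ.+ t))
    if-false : ∀ {b c d s s′ t} → evalᵇ b s ≡ false →
      Exec f d s s′ t → Exec f (IF b THEN c ELSE d) s s′ (suc (costᵇ b ℕ.+ t))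
    while-true : ∀ {b c s s′ s″ t u} → evalᵇ b s ≡ true →
      Exec f c s s′ t → Exec f (WHILE b DO c) s′ s″ u →
      Exec f (WHILE b DO c) s s″ (suc (costᵇ b ℕ.+ (t ℕ.+ u)))
    while-false : ∀ {b c s} → evalᵇ b s ≡ false →
      Exec f (WHILE b DO c) s s (suc (costᵇ b))

  toArray : ∀ {n} → Vec ℕ n → ℕ → ℕ
  toArray []       _       = 0
  toArray (b ∷ bs) zero    = b
  toArray (b ∷ bs) (suc i) = toArray bs i

  -- Input: n and B in natural-number registers 0 and 1, ε in real register 0,
  -- the Bᵢ in natural-number array 1; every other cell is zero.
  -- Output: natural-number array 0.
  initial : ∀ {n} → Carrier → ℕ → Vec ℕ n → State
  initial {n} ε B Bs = mkState
    (update (update (λ _ → 0) 1 B) 0 n)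
    (update (λ _ → 0#) 0 ε)
    (update (λ _ _ → 0) 1 (toArray Bs))
    (λ _ _ → 0#)

  output : (n : ℕ) → State → Vec ℕ n
  output n = readVec n 0

------------------------------------------------------------------------

module _ (ℝ : RealNumbers) where
  open RealNumbers ℝ
  open Semantics ℝ

  Approximates : ∀ {n} → Carrier → ℕ → Vec ℕ n → (Vec ℕ n → Carrier) → Vec ℕ n → Set
  Approximates ε B Bs f x = Feasible B Bs x ×
    (∃[ M ] IsMaximum ℝ f (Feasible B Bs) M × (1# - 1# ÷ e - ε) * M ≤ f x)

  -- The 1 + accounts for the O-notation: the bound itself vanishes for n = 0
  -- and tends to 0 as ε → 1 with n = B₀ = 1, while every run takes a step.
  RunsInTime : ∀ {n} → Carrier → Carrier → Vec ℕ n → ℕ → Set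
  RunsInTime C ε Bs t =
    fromℕ t ≤ C * (1# + timeBound ℝ (size ℝ ε Bs) ε)

{-# OPTIONS --safe #-}
-- The algorithm is a decreasing-threshold greedy. It starts from
-- g = Σᵢ (f(min(Bᵢ, B) χᵢ) - f(0)), which by subadditivity satisfies
-- OPT - f(0) ≤ g ≤ n OPT, and divides g by 1 + ε until n g ≤ ε Σᵢ (...); this takes
-- O(log(n/ε)/ε) passes. A pass offers, for each item i, chunks of 2^j copies of i for
-- decreasing j, and adds a chunk if it fits and gains at least g/B per copy.
-- If 2^(j+1) copies are too many, then so are 2^j copies after adding or rejecting one
-- chunk of 2^j copies; so after j = 0 not even a single copy is acceptable. By
-- diminishing returns OPT - f(x) ≤ g after a pass unless the budget is used up, and
-- every copy added in the next pass closes at least a fraction 1/((1 + ε)B) of the gap.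
-- With the budget used up, the gap is at most (1 - 1/((1 + ε)B))^B OPT ≤ (1/e + ε) OPT.
module Submission where

open import Defs
open import Algebra.Bundles using (CommutativeRing)
open import Data.Bool.Base using (true; false; T; _∧_; if_then_else_)
open import Data.Empty using (⊥-elim)
open import Data.Fin.Base using (Fin; zero; suc; toℕ; fromℕ<)
import Data.Fin.Properties as Fin
open import Data.Integer.Base as ℤ using (ℤ; -[1+_]) renaming (+_ to pos)
import Data.Integer.Properties as ℤ
open import Data.Maybe.Base using (Maybe; just; nothing)
open import Data.Nat.Base as ℕ using (ℕ; zero; suc; _≤ᵇ_; _≡ᵇ_)
import Data.Nat.Properties as ℕ
open import Data.Nat.Solver using (module +-*-Solver)
open import Data.Product.Base using (Σ-syntax; ∃-syntax; _×_; _,_; proj₁; proj₂)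
open import Data.Sign.Base as Sign using ()
open import Data.Sum.Base as Sum using (_⊎_; inj₁; inj₂)
open import Data.Unit.Base using (tt)
open import Data.Vec.Base as Vec using (Vec; []; _∷_; lookup; replicate; zipWith; tabulate; _[_]≔_)
import Data.Vec.Properties as Vec
open import Data.Vec.Relation.Binary.Pointwise.Inductive as PW using ([]; _∷_)
open import Function.Base using (_∘_)
open import Relation.Binary.Bundles using (Poset)
open import Relation.Binary.Construct.Closure.ReflexiveTransitive as Star using (Star; _◅_; _◅◅_)
open import Relation.Binary.PropositionalEquality as ≡ using (_≡_; _≢_; refl; sym; trans; cong; cong₂; subst; subst₂)
open import Relation.Binary.Structures using (IsDecTotalOrder)
open import Relation.Nullary.Decidable.Core using (Dec; yes; no; does)
open import Relation.Nullary.Negation.Core using (¬_; contradiction)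
open import Relation.Unary using (Decidable)
import Algebra.Properties.AbelianGroup
import Algebra.Properties.CommutativeSemiring.Exp
import Algebra.Properties.Ring
import Algebra.Properties.Semiring.Exp
import Algebra.Properties.Semiring.Mult
import Algebra.Properties.Semiring.Mult.TCOptimised
import Algebra.Solver.Ring
import Relation.Binary.Reasoning.PartialOrder
import Relation.Binary.Reasoning.Setoid
open import Algebra.Properties.CommutativeSemigroup ℕ.+-commutativeSemigroup using (interchange)
open import Algebra.Solver.Ring.AlmostCommutativeRing using (fromCommutativeRing; _-Raw-AlmostCommutative⟶_)
open +-*-Solver using () renaming (solve to solveⁿ; con to conⁿ; _:+_ to _:+ⁿ_; _:*_ to _:*ⁿ_; _:=_ to _:=ⁿ_)

-- A single visit per item suffices in a pass because every reason to be done with an item (budget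
-- spent, bound reached, marginal gain below the threshold) survives later additions to other items.
-- Scaling the threshold by `B` makes `g` directly comparable with the gap OPT - f(x): the invariant
-- gap ≤ g of one pass reads gap ≤ (1 + ε) g' for the next value g', and it persists during that
-- pass as the gap can only fall. By Bernoulli a chunk of k copies shrinks the gap like k single
-- copies, so the final estimate depends only on how many copies were added and not on their
-- grouping. The alternative "budget used up" has to be carried along: from then on `g` keeps
-- falling while the gap stands still. The program evaluates no logarithm, and the number of passes
-- exists only in the analysis. About 1/ε divisions halve `g`, and j + 1 halvings are enough, where
-- 2^j ≤ n/ε ≤ m/ε; this is the source of the factor log(m/ε).

module RingSolver {c ℓ} (R : CommutativeRing c ℓ) where
  open CommutativeRing R renaming (refl to ≈-refl; sym to ≈-sym; trans to ≈-trans)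
  open Algebra.Properties.Ring ring
  open Algebra.Properties.AbelianGroup +-abelianGroup using (⁻¹-∙-comm)
  open Algebra.Properties.Semiring.Mult.TCOptimised semiring renaming (_×_ to _·_)
  open Relation.Binary.Reasoning.Setoid setoid

  -- With the optimised multiple the integers 0, 1 and 2 evaluate to `0#`, `1#` and `1# + 1#` on the
  -- nose, so the solver's constants match those of the goals, `2#` included.
  fromℤ : ℤ → Carrier
  fromℤ (pos n)  = n · 1#
  fromℤ -[1+ n ] = - (suc n · 1#)

  fromℤ-neg : ∀ i → fromℤ (ℤ.- i) ≈ - fromℤ i
  fromℤ-neg (pos zero)    = ≈-sym -0#≈0#
  fromℤ-neg (pos (suc n)) = ≈-refl
  fromℤ-neg -[1+ n ]      = ≈-sym (-‿involutive _)

  fromℤ-⊖ : ∀ m n → fromℤ (m ℤ.⊖ n) ≈ m · 1# - n · 1#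
  fromℤ-⊖ m       zero    = begin
    m · 1#            ≈⟨ +-identityʳ _ ⟨
    m · 1# + 0#       ≈⟨ +-congˡ -0#≈0# ⟨
    m · 1# - 0#       ∎
  fromℤ-⊖ zero    (suc n) = ≈-sym (+-identityˡ _)
  fromℤ-⊖ (suc m) (suc n) = begin
    fromℤ (suc m ℤ.⊖ suc n)                 ≡⟨ ≡.cong fromℤ (ℤ.[1+m]⊖[1+n]≡m⊖n m n) ⟩
    fromℤ (m ℤ.⊖ n)                         ≈⟨ fromℤ-⊖ m n ⟩
    m · 1# - n · 1#                         ≈⟨ +-congʳ (+-identityˡ _) ⟨
    (0# + m · 1#) - n · 1#                  ≈⟨ +-congʳ (+-congʳ (-‿inverseʳ 1#)) ⟨
    (1# - 1# + m · 1#) - n · 1#             ≈⟨ +-congʳ (≈-trans (+-assoc _ _ _) (+-congˡ (+-comm _ _))) ⟩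
    (1# + (m · 1# - 1#)) - n · 1#           ≈⟨ +-congʳ (+-assoc _ _ _) ⟨
    (1# + m · 1# - 1#) - n · 1#             ≈⟨ +-assoc _ _ _ ⟩
    1# + m · 1# + (- 1# - n · 1#)           ≈⟨ +-congˡ (⁻¹-∙-comm _ _) ⟩
    1# + m · 1# - (1# + n · 1#)             ≈⟨ +-cong (1+× m 1#) (-‿cong (1+× n 1#)) ⟨
    suc m · 1# - suc n · 1#                 ∎

  fromℤ-+ : ∀ i j → fromℤ (i ℤ.+ j) ≈ fromℤ i + fromℤ j
  fromℤ-+ (pos m)  (pos n)  = ×-homo-+ 1# m n
  fromℤ-+ (pos m)  -[1+ n ] = fromℤ-⊖ m (suc n)
  fromℤ-+ -[1+ m ] (pos n)  = ≈-trans (fromℤ-⊖ n (suc m)) (+-comm _ _)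
  fromℤ-+ -[1+ m ] -[1+ n ] = begin
    - (suc (suc (m ℕ.+ n)) · 1#)     ≡⟨ ≡.cong (λ k → - (suc k · 1#)) (≡.sym (ℕ.+-suc m n)) ⟩
    - ((suc m ℕ.+ suc n) · 1#)       ≈⟨ -‿cong (×-homo-+ 1# (suc m) (suc n)) ⟩
    - (suc m · 1# + suc n · 1#)      ≈⟨ ⁻¹-∙-comm _ _ ⟨
    - (suc m · 1#) - suc n · 1#      ∎

  fromℤ-* : ∀ i j → fromℤ (i ℤ.* j) ≈ fromℤ i * fromℤ j
  fromℤ-* (pos m) (pos n) = begin
    fromℤ (Sign.+ ℤ.◃ m ℕ.* n)  ≡⟨ ≡.cong fromℤ (ℤ.+◃n≡+n (m ℕ.* n)) ⟩
    (m ℕ.* n) · 1#              ≈⟨ ×1-homo-* m n ⟩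
    (m · 1#) * (n · 1#)         ∎
  fromℤ-* (pos m) -[1+ n ] = begin
    fromℤ (Sign.- ℤ.◃ m ℕ.* suc n)  ≡⟨ ≡.cong fromℤ (ℤ.-◃n≡-n (m ℕ.* suc n)) ⟩
    fromℤ (ℤ.- pos (m ℕ.* suc n))   ≈⟨ fromℤ-neg (pos (m ℕ.* suc n)) ⟩
    - ((m ℕ.* suc n) · 1#)          ≈⟨ -‿cong (×1-homo-* m (suc n)) ⟩
    - ((m · 1#) * (suc n · 1#))     ≈⟨ -‿distribʳ-* _ _ ⟩
    (m · 1#) * - (suc n · 1#)       ∎
  fromℤ-* -[1+ m ] (pos n) = begin
    fromℤ (Sign.- ℤ.◃ suc m ℕ.* n)  ≡⟨ ≡.cong fromℤ (ℤ.-◃n≡-n (suc m ℕ.* n)) ⟩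
    fromℤ (ℤ.- pos (suc m ℕ.* n))   ≈⟨ fromℤ-neg (pos (suc m ℕ.* n)) ⟩
    - ((suc m ℕ.* n) · 1#)          ≈⟨ -‿cong (×1-homo-* (suc m) n) ⟩
    - ((suc m · 1#) * (n · 1#))     ≈⟨ -‿distribˡ-* _ _ ⟩
    - (suc m · 1#) * (n · 1#)       ∎
  fromℤ-* -[1+ m ] -[1+ n ] = begin
    (suc m ℕ.* suc n) · 1#          ≈⟨ ×1-homo-* (suc m) (suc n) ⟩
    (suc m · 1#) * (suc n · 1#)     ≈⟨ -‿involutive _ ⟨
    - - ((suc m · 1#) * (suc n · 1#))   ≈⟨ -‿cong (-‿distribʳ-* _ _) ⟩
    - ((suc m · 1#) * - (suc n · 1#))   ≈⟨ -‿distribˡ-* _ _ ⟩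
    - (suc m · 1#) * - (suc n · 1#) ∎

  ℤ⟶R : ℤ.+-*-rawRing -Raw-AlmostCommutative⟶ fromCommutativeRing R
  ℤ⟶R = record
    { ⟦_⟧    = fromℤ
    ; +-homo = fromℤ-+
    ; *-homo = fromℤ-*
    ; -‿homo = fromℤ-neg
    ; 0-homo = ≈-refl
    ; 1-homo = ≈-refl
    }

  fromℤ-≟ : ∀ i j → Maybe (fromℤ i ≈ fromℤ j)
  fromℤ-≟ i j with i ℤ.≟ j
  ... | yes i≡j = just (reflexive (≡.cong fromℤ i≡j))
  ... | no  _   = nothing

  open Algebra.Solver.Ring ℤ.+-*-rawRing (fromCommutativeRing R) ℤ⟶R fromℤ-≟ public
    using (solve; _:=_; _:+_; _:*_; _:-_; :-_; con; Polynomial)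

  0: 1: 2: : ∀ {n} → Polynomial n
  0: = con (pos 0)
  1: = con (pos 1)
  2: = con (pos 2)

-- Arithmetic in a complete ordered field

module Reals (ℝ : RealNumbers) where
  open RealNumbers ℝ public
  open IsDecTotalOrder isDecTotalOrder public
    using (_≟_; total; antisym) renaming (refl to ≤-refl; trans to ≤-trans; reflexive to ≤-reflexive)
  open RingSolver commutativeRing public using (solve; _:=_; _:+_; _:*_; _:-_; :-_; 0:; 1:; 2:)
  open CommutativeRing commutativeRing public
    using (+-identityˡ; +-identityʳ; *-identityˡ; *-identityʳ; *-comm; *-assoc; +-comm; +-assoc; zeroˡ; zeroʳ; -‿inverseʳ)
  open Algebra.Properties.Semiring.Exp semiring public using (^-homo-*; ^-assocʳ)
  open Algebra.Properties.CommutativeSemiring.Exp (CommutativeRing.commutativeSemiring commutativeRing) public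
    using (^-distrib-*)
  open Algebra.Properties.Semiring.Mult semiring using (×-homo-+; ×1-homo-*)

  ≤-poset : Poset _ _ _
  ≤-poset = record { isPartialOrder = IsDecTotalOrder.isPartialOrder isDecTotalOrder }

  module ≤-Reasoning = Relation.Binary.Reasoning.PartialOrder ≤-poset
    hiding (step-≈; step-≈-⟩; step-≈-⟨)

  private variable
    u v x y z : Carrier

  ≰⇒≥ : ¬ x ≤ y → y ≤ x
  ≰⇒≥ {x} {y} x≰y with total x y
  ... | inj₁ x≤y = ⊥-elim (x≰y x≤y)
  ... | inj₂ y≤x = y≤x

  x≤y⇒0≤y-x : x ≤ y → 0# ≤ y - x
  x≤y⇒0≤y-x {x} {y} x≤y = subst (_≤ y - x) (-‿inverseʳ x) (+-monoˡ-≤ (- x) x≤y)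

  -- Linear arithmetic: x ≤ y is certified by writing y - x as a combination
  -- of nonnegative terms, the identity being left to the ring solver.
  ≤-by : 0# ≤ z → y - x ≡ z → x ≤ y
  ≤-by {z} {y} {x} 0≤z eq = subst₂ _≤_ (+-identityˡ x) (solve 2 (λ x y → (y :- x) :+ x := y) refl x y)
    (+-monoˡ-≤ x (subst (0# ≤_) (sym eq) 0≤z))

  +-nonNeg : 0# ≤ x → 0# ≤ y → 0# ≤ x + y
  +-nonNeg {x} {y} 0≤x 0≤y = ≤-trans (subst (0# ≤_) (sym (+-identityˡ y)) 0≤y) (+-monoˡ-≤ y 0≤x)

  -- An equation as a nonnegative term, for use with ≤-by.
  eq-nonNeg : ∀ z → x ≡ y → 0# ≤ z * (x - y)
  eq-nonNeg {x} z refl = ≤-reflexive (solve 2 (λ x z → 0: := z :* (x :- x)) refl x z)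

  +-mono-≤ : x ≤ y → u ≤ v → x + u ≤ y + v
  +-mono-≤ {x} {y} {u} {v} x≤y u≤v = ≤-by (+-nonNeg (x≤y⇒0≤y-x x≤y) (x≤y⇒0≤y-x u≤v))
    (solve 4 (λ x y u v → (y :+ v) :- (x :+ u) := (y :- x) :+ (v :- u)) refl x y u v)

  *-monoʳ-≤ : 0# ≤ z → x ≤ y → z * x ≤ z * y
  *-monoʳ-≤ {z} {x} {y} 0≤z x≤y = ≤-by (*-nonNeg 0≤z (x≤y⇒0≤y-x x≤y))
    (solve 3 (λ x y z → z :* y :- z :* x := z :* (y :- x)) refl x y z)

  *-monoˡ-≤ : 0# ≤ z → x ≤ y → x * z ≤ y * z
  *-monoˡ-≤ {z} {x} {y} 0≤z x≤y = subst₂ _≤_ (*-comm z x) (*-comm z y) (*-monoʳ-≤ 0≤z x≤y)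

  *-mono-≤ : 0# ≤ x → x ≤ y → 0# ≤ u → u ≤ v → x * u ≤ y * v
  *-mono-≤ 0≤x x≤y 0≤u u≤v = ≤-trans (*-monoˡ-≤ 0≤u x≤y) (*-monoʳ-≤ (≤-trans 0≤x x≤y) u≤v)

  square-nonNeg : ∀ x → 0# ≤ x * x
  square-nonNeg x with total 0# x
  ... | inj₁ 0≤x = *-nonNeg 0≤x 0≤x
  ... | inj₂ x≤0 = subst (0# ≤_) (solve 1 (λ x → (0: :- x) :* (0: :- x) := x :* x) refl x)
                     (*-nonNeg (x≤y⇒0≤y-x x≤0) (x≤y⇒0≤y-x x≤0))

  0≤1 : 0# ≤ 1#
  0≤1 = subst (0# ≤_) (*-identityˡ 1#) (square-nonNeg 1#)

  0<1 : 0# < 1#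
  0<1 = 0≤1 , 0≢1

  <-≤-trans : x < y → y ≤ z → x < z
  <-≤-trans (x≤y , x≢y) y≤z = ≤-trans x≤y y≤z , λ { refl → x≢y (antisym x≤y y≤z) }

  ⁻¹-nonNeg : 0# < x → 0# ≤ x ⁻¹
  ⁻¹-nonNeg {x} (0≤x , 0≢x) with total 0# (x ⁻¹)
  ... | inj₁ 0≤x⁻¹ = 0≤x⁻¹
  ... | inj₂ x⁻¹≤0 = ⊥-elim (0≢1 (antisym 0≤1 (subst₂ _≤_ (*-inverseʳ x (λ eq → 0≢x (sym eq))) (zeroʳ x)
                       (*-monoʳ-≤ 0≤x x⁻¹≤0))))

  ÷-nonNeg : 0# ≤ x → 0# < y → 0# ≤ x ÷ y
  ÷-nonNeg 0≤x 0<y = *-nonNeg 0≤x (⁻¹-nonNeg 0<y)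

  *-inverse-pos : 0# < x → x * x ⁻¹ ≡ 1#
  *-inverse-pos {x} (_ , 0≢x) = *-inverseʳ x (λ eq → 0≢x (sym eq))

  x÷y*y≡x : ∀ x → 0# < y → x ÷ y * y ≡ x
  x÷y*y≡x {y} x 0<y = begin-equality
    x ÷ y * y        ≡⟨ solve 3 (λ x y z → x :* z :* y := x :* (y :* z)) refl x y (y ⁻¹) ⟩
    x * (y * y ⁻¹)   ≡⟨ cong (x *_) (*-inverse-pos 0<y) ⟩
    x * 1#           ≡⟨ *-identityʳ x ⟩
    x                ∎
    where open ≤-Reasoning

  *-cancelʳ-≤ : 0# < z → x * z ≤ y * z → x ≤ y
  *-cancelʳ-≤ {z} {x} {y} 0<z xz≤yz = subst₂ _≤_ (eq x) (eq y) (*-monoˡ-≤ (⁻¹-nonNeg 0<z) xz≤yz)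
    where
    eq : ∀ x → x * z * z ⁻¹ ≡ x
    eq x = trans (*-assoc x z _) (trans (cong (x *_) (*-inverse-pos 0<z)) (*-identityʳ x))

  x≤y*z⇒x÷z≤y : 0# < z → x ≤ y * z → x ÷ z ≤ y
  x≤y*z⇒x÷z≤y {z} {x} {y} 0<z x≤yz = *-cancelʳ-≤ 0<z (subst (_≤ y * z) (sym (x÷y*y≡x x 0<z)) x≤yz)

  x*z≤y⇒x≤y÷z : 0# < z → x * z ≤ y → x ≤ y ÷ z
  x*z≤y⇒x≤y÷z {z} {x} {y} 0<z xz≤y = *-cancelʳ-≤ 0<z (subst (x * z ≤_) (sym (x÷y*y≡x y 0<z)) xz≤y)

  fromℕ-+ : ∀ m n → fromℕ (m ℕ.+ n) ≡ fromℕ m + fromℕ n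
  fromℕ-+ = ×-homo-+ 1#

  fromℕ-* : ∀ m n → fromℕ (m ℕ.* n) ≡ fromℕ m * fromℕ n
  fromℕ-* = ×1-homo-*

  fromℕ-1 : fromℕ 1 ≡ 1#
  fromℕ-1 = +-identityʳ 1#

  fromℕ-nonNeg : ∀ n → 0# ≤ fromℕ n
  fromℕ-nonNeg zero    = ≤-refl
  fromℕ-nonNeg (suc n) = +-nonNeg 0≤1 (fromℕ-nonNeg n)

  fromℕ-mono : ∀ {m n} → m ℕ.≤ n → fromℕ m ≤ fromℕ n
  fromℕ-mono {n = n} ℕ.z≤n = fromℕ-nonNeg n
  fromℕ-mono (ℕ.s≤s m≤n)   = +-mono-≤ ≤-refl (fromℕ-mono m≤n)

  1≤fromℕ-suc : ∀ n → 1# ≤ fromℕ (suc n)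
  1≤fromℕ-suc n = subst (_≤ fromℕ (suc n)) fromℕ-1 (fromℕ-mono {1} {suc n} (ℕ.s≤s ℕ.z≤n))

  0<fromℕ-suc : ∀ n → 0# < fromℕ (suc n)
  0<fromℕ-suc n = <-≤-trans 0<1 (1≤fromℕ-suc n)

  fromℕ-cancel-≤ : ∀ {m n} → fromℕ m ≤ fromℕ n → m ℕ.≤ n
  fromℕ-cancel-≤ {m} {n} le = ℕ.≮⇒≥ λ n<m → 0≢1 (antisym 0≤1 (≤-by
    (x≤y⇒0≤y-x (≤-trans (fromℕ-mono n<m) le))
    (solve 1 (λ n → 0: :- 1: := n :- (1: :+ n)) refl (fromℕ n))))

  ^-nonNeg : ∀ n → 0# ≤ x → 0# ≤ x ^ n
  ^-nonNeg zero    0≤x = 0≤1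
  ^-nonNeg (suc n) 0≤x = *-nonNeg 0≤x (^-nonNeg n 0≤x)

  ^-monoˡ-≤ : ∀ n → 0# ≤ x → x ≤ y → x ^ n ≤ y ^ n
  ^-monoˡ-≤ zero    0≤x x≤y = ≤-refl
  ^-monoˡ-≤ (suc n) 0≤x x≤y = *-mono-≤ 0≤x x≤y (^-nonNeg n 0≤x) (^-monoˡ-≤ n 0≤x x≤y)

  1^n≡1 : ∀ n → 1# ^ n ≡ 1#
  1^n≡1 zero    = refl
  1^n≡1 (suc n) = trans (*-identityˡ _) (1^n≡1 n)

  ^-≤1 : ∀ n → 0# ≤ x → x ≤ 1# → x ^ n ≤ 1#
  ^-≤1 {x} n 0≤x x≤1 = subst (x ^ n ≤_) (1^n≡1 n) (^-monoˡ-≤ n 0≤x x≤1)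

  1≤^ : ∀ n → 1# ≤ x → 1# ≤ x ^ n
  1≤^ {x} n 1≤x = subst (_≤ x ^ n) (1^n≡1 n) (^-monoˡ-≤ n 0≤1 1≤x)

  -- The range x ≥ -1 is wanted because `1-n*x≤[1-x]^n` applies it to a negative argument. The
  -- induction step drops the term n x².
  bernoulli : ∀ n x → 0# ≤ 1# + x → 1# + fromℕ n * x ≤ (1# + x) ^ n
  bernoulli zero    x 0≤1+x = ≤-reflexive (solve 1 (λ x → 1: :+ 0: :* x := 1:) refl x)
  bernoulli (suc n) x 0≤1+x = ≤-trans
    (≤-by (*-nonNeg (fromℕ-nonNeg n) (square-nonNeg x))
      (solve 2 (λ x n → (1: :+ x) :* (1: :+ n :* x) :- (1: :+ (1: :+ n) :* x) := n :* (x :* x)) refl x (fromℕ n)))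
    (*-monoʳ-≤ 0≤1+x (bernoulli n x 0≤1+x))

  1-n*x≤[1-x]^n : ∀ n x → x ≤ 1# → 1# - fromℕ n * x ≤ (1# - x) ^ n
  1-n*x≤[1-x]^n n x x≤1 = subst (_≤ (1# - x) ^ n) (solve 2 (λ x n → 1: :+ n :* :- x := 1: :- n :* x) refl x (fromℕ n))
    (bernoulli n (- x) (x≤y⇒0≤y-x x≤1))

  -- The mean value inequality for the n-th power on [0, 1], where its derivative is at most n.
  ^-difference : ∀ n → 0# ≤ x → x ≤ y → y ≤ 1# → y ^ n - x ^ n ≤ fromℕ n * (y - x)
  ^-difference {x} {y} zero    0≤x x≤y y≤1 = ≤-reflexive (solve 2 (λ x y → 1: :- 1: := 0: :* (y :- x)) refl x y)
  ^-difference {x} {y} (suc n) 0≤x x≤y y≤1 = begin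
    y * y ^ n - x * x ^ n
      ≡⟨ solve 4 (λ x y a b → y :* b :- x :* a := y :* (b :- a) :+ (y :- x) :* a) refl x y (x ^ n) (y ^ n) ⟩
    y * (y ^ n - x ^ n) + (y - x) * x ^ n
      ≤⟨ +-mono-≤ (*-mono-≤ (≤-trans 0≤x x≤y) y≤1 (x≤y⇒0≤y-x (^-monoˡ-≤ n 0≤x x≤y)) (^-difference n 0≤x x≤y y≤1))
           (*-monoʳ-≤ (x≤y⇒0≤y-x x≤y) (^-≤1 n 0≤x (≤-trans x≤y y≤1))) ⟩
    1# * (fromℕ n * (y - x)) + (y - x) * 1#
      ≡⟨ solve 3 (λ x y n → 1: :* (n :* (y :- x)) :+ (y :- x) :* 1: := (1: :+ n) :* (y :- x)) refl x y (fromℕ n) ⟩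
    fromℕ (suc n) * (y - x) ∎
    where open ≤-Reasoning

  0≤2 : 0# ≤ 2#
  0≤2 = +-nonNeg 0≤1 0≤1

  fromℕ-2^ : ∀ n → fromℕ (2 ℕ.^ n) ≡ 2# ^ n
  fromℕ-2^ zero    = fromℕ-1
  fromℕ-2^ (suc n) = trans (fromℕ-* 2 (2 ℕ.^ n))
    (cong₂ _*_ (solve 0 (1: :+ (1: :+ 0:) := 2:) refl) (fromℕ-2^ n))

  2^-cancel-≤ : ∀ {m n} → 2# ^ m ≤ 2# ^ n → m ℕ.≤ n
  2^-cancel-≤ {m} {n} le = ℕ.≮⇒≥ λ n<m → ℕ.<⇒≱ (ℕ.^-monoʳ-< 2 (ℕ.s≤s (ℕ.s≤s ℕ.z≤n)) n<m)
    (fromℕ-cancel-≤ (subst₂ _≤_ (sym (fromℕ-2^ m)) (sym (fromℕ-2^ n)) le))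

  n≤2^n : ∀ n → n ℕ.≤ 2 ℕ.^ n
  n≤2^n zero    = ℕ.z≤n
  n≤2^n (suc n) = ℕ.+-mono-≤ (ℕ.m^n>0 2 n) (ℕ.≤-trans (n≤2^n n) (ℕ.m≤m+n _ 0))

  ≤2^ : ∀ x → ∃[ k ] x ≤ 2# ^ k
  ≤2^ x with archimedean x
  ... | k , x≤k = k , ≤-trans x≤k (subst (fromℕ k ≤_) (fromℕ-2^ k) (fromℕ-mono (n≤2^n k)))

  -- The number e

  private
    inv : ℕ → Carrier
    inv n = 1# ÷ fromℕ (suc n)

    inv-nonNeg : ∀ n → 0# ≤ inv n
    inv-nonNeg n = ÷-nonNeg 0≤1 (0<fromℕ-suc n)

    inv-inverse : ∀ n → inv n * fromℕ (suc n) ≡ 1#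
    inv-inverse n = x÷y*y≡x 1# (0<fromℕ-suc n)

    inv-≤1 : ∀ n → inv n ≤ 1#
    inv-≤1 n = x≤y*z⇒x÷z≤y (0<fromℕ-suc n) (subst (1# ≤_) (sym (*-identityˡ _)) (1≤fromℕ-suc n))

    -- With both arguments shifted by one: 1/k = n/(kn).
    inv-* : ∀ k n → inv k ≡ fromℕ (suc n) * inv (n ℕ.+ k ℕ.* suc n)
    inv-* k n = begin-equality
      inv k                           ≡⟨ *-identityʳ _ ⟨
      inv k * 1#                      ≡⟨ cong (inv k *_) (inv-inverse (n ℕ.+ k ℕ.* suc n)) ⟨
      inv k * (w * fromℕ (suc k ℕ.* suc n))  ≡⟨ cong (λ h → inv k * (w * h)) (fromℕ-* (suc k) (suc n)) ⟩
      inv k * (w * (K * N))           ≡⟨ solve 4 (λ i w K N → i :* (w :* (K :* N)) := (i :* K) :* (N :* w)) refl (inv k) w K N ⟩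
      (inv k * K) * (N * w)           ≡⟨ cong (_* (N * w)) (inv-inverse k) ⟩
      1# * (N * w)                    ≡⟨ *-identityˡ _ ⟩
      N * w                           ∎
      where
      open ≤-Reasoning
      w = inv (n ℕ.+ k ℕ.* suc n)
      K = fromℕ (suc k)
      N = fromℕ (suc n)

  -- With u = 1/(kn), Bernoulli gives 1 + 1/k ≤ (1 + u)^n and 1 - 1/n ≤ (1 - u)^k,
  -- and (1 + u)(1 - u) ≤ 1.
  e-approximants : ∀ k n → (1# + 1# ÷ fromℕ (suc k)) ^ suc k * (1# - 1# ÷ fromℕ (suc n)) ^ suc n ≤ 1#
  e-approximants k n = begin
    (1# + inv k) ^ suc k * (1# - inv n) ^ suc n
      ≤⟨ *-mono-≤ (^-nonNeg (suc k) 0≤1+inv) (^-monoˡ-≤ (suc k) 0≤1+inv upper)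
                  (^-nonNeg (suc n) 0≤1-inv) (^-monoˡ-≤ (suc n) 0≤1-inv lower) ⟩
    ((1# + w) ^ suc n) ^ suc k * ((1# - w) ^ suc k) ^ suc n
      ≡⟨ cong₂ _*_ (^-assocʳ (1# + w) (suc n) (suc k)) (^-assocʳ (1# - w) (suc k) (suc n)) ⟩
    (1# + w) ^ (suc n ℕ.* suc k) * (1# - w) ^ (suc k ℕ.* suc n)
      ≡⟨ cong (λ h → (1# + w) ^ h * (1# - w) ^ (suc k ℕ.* suc n)) (ℕ.*-comm (suc n) (suc k)) ⟩
    (1# + w) ^ (suc k ℕ.* suc n) * (1# - w) ^ (suc k ℕ.* suc n)
      ≡⟨ ^-distrib-* (1# + w) (1# - w) (suc k ℕ.* suc n) ⟨
    ((1# + w) * (1# - w)) ^ (suc k ℕ.* suc n)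
      ≤⟨ ^-≤1 (suc k ℕ.* suc n) (*-nonNeg 0≤1+w 0≤1-w)
           (≤-by (square-nonNeg w) (solve 1 (λ w → 1: :- (1: :+ w) :* (1: :- w) := w :* w) refl w)) ⟩
    1# ∎
    where
    open ≤-Reasoning
    w = inv (n ℕ.+ k ℕ.* suc n)
    0≤1+inv = +-nonNeg 0≤1 (inv-nonNeg k)
    0≤1-inv = x≤y⇒0≤y-x (inv-≤1 n)
    0≤1+w   = +-nonNeg 0≤1 (inv-nonNeg (n ℕ.+ k ℕ.* suc n))
    w≤1     = inv-≤1 (n ℕ.+ k ℕ.* suc n)
    0≤1-w   = x≤y⇒0≤y-x w≤1
    upper : 1# + inv k ≤ (1# + w) ^ suc n
    upper = subst (λ h → 1# + h ≤ (1# + w) ^ suc n) (sym (inv-* k n)) (bernoulli (suc n) w 0≤1+w)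
    w-sym : w ≡ inv (k ℕ.+ n ℕ.* suc k)
    w-sym = cong (λ h → 1# ÷ fromℕ h) (ℕ.*-comm (suc k) (suc n))
    lower : 1# - inv n ≤ (1# - w) ^ suc k
    lower = subst (λ h → 1# - h ≤ (1# - w) ^ suc k)
      (sym (trans (inv-* n k) (cong (fromℕ (suc k) *_) (sym w-sym)))) (1-n*x≤[1-x]^n (suc k) w w≤1)

  private
    E : Carrier → Set
    E y = ∃[ k ] y ≡ (1# + 1# ÷ fromℕ (suc k)) ^ suc k

    E-bound : ∀ n → 0# < (1# - inv n) ^ suc n → UpperBound E (((1# - inv n) ^ suc n) ⁻¹)
    E-bound n 0<b y (k , refl) = subst (y ≤_) (*-identityˡ _) (x*z≤y⇒x≤y÷z 0<b (e-approximants k n))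

    0<½^2 : 0# < (1# - inv 1) ^ 2
    0<½^2 = ^-nonNeg 2 (x≤y⇒0≤y-x (inv-≤1 1)) , λ 0≡¼ → 0≢1 (begin-equality
      0#                                            ≡⟨ solve 1 (λ f → 0: := f :* f :* 0:) refl (fromℕ 2) ⟩
      fromℕ 2 * fromℕ 2 * 0#                        ≡⟨ cong (fromℕ 2 * fromℕ 2 *_) 0≡¼ ⟩
      fromℕ 2 * fromℕ 2 * (1# - inv 1) ^ 2          ≡⟨ solve 2 (λ f i → f :* f :* ((1: :- i) :* ((1: :- i) :* 1:)) := (f :- i :* f) :* (f :- i :* f)) refl (fromℕ 2) (inv 1) ⟩
      (fromℕ 2 - inv 1 * fromℕ 2) * (fromℕ 2 - inv 1 * fromℕ 2)  ≡⟨ cong (λ h → (fromℕ 2 - h) * (fromℕ 2 - h)) (inv-inverse 1) ⟩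
      (fromℕ 2 - 1#) * (fromℕ 2 - 1#)               ≡⟨ solve 0 (((1: :+ (1: :+ 0:)) :- 1:) :* ((1: :+ (1: :+ 0:)) :- 1:) := 1:) refl ⟩
      1#                                            ∎)
      where open ≤-Reasoning

    e-isSupremum : IsSupremum E e
    -- Index 1 gives the upper bound 4, the inverse of (1 - 1/2)²; at index 0 the base would be 0.
    e-isSupremum = sup-lub E (_ , 0 , refl) (_ , E-bound 1 0<½^2)

  0<e : 0# < e
  0<e = <-≤-trans 0<1 (≤-trans (1≤^ 1 (≤-by (inv-nonNeg 0) (solve 1 (λ x → 1: :+ x :- 1: := x) refl (inv 0))))
                               (proj₁ e-isSupremum _ (0 , refl)))

  0≤1÷e : 0# ≤ 1# ÷ e
  0≤1÷e = ÷-nonNeg 0≤1 0<e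

  -- As a least upper bound, `e` lies below the bound 1/b of `E-bound`. If b vanishes, as it does
  -- for exponent 1, the claim is trivial.
  [1-1/n]^n≤1÷e : ∀ n → (1# - 1# ÷ fromℕ (suc n)) ^ suc n ≤ 1# ÷ e
  [1-1/n]^n≤1÷e n with 0# ≟ (1# - inv n) ^ suc n
  ... | yes 0≡b = subst (_≤ 1# ÷ e) 0≡b 0≤1÷e
  ... | no  0≢b = x*z≤y⇒x≤y÷z 0<e (subst (b * e ≤_) (*-inverse-pos 0<b)
                    (*-monoʳ-≤ (proj₁ 0<b) (proj₂ e-isSupremum _ (E-bound n 0<b))))
    where
    b = (1# - inv n) ^ suc n
    0<b : 0# < b
    0<b = ^-nonNeg (suc n) (x≤y⇒0≤y-x (inv-≤1 n)) , 0≢b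

  -- The slack: a^n - b^n ≤ n (a - b) for a = 1 - c/n and b = 1 - 1/n, and 1 - c = c ε.
  [1-c/n]^n≤1÷e+ε : ∀ n {c ε} → 0# ≤ ε → 0# ≤ c → c * (1# + ε) ≡ 1# →
                    (1# - c ÷ fromℕ (suc n)) ^ suc n ≤ 1# ÷ e + ε
  [1-c/n]^n≤1÷e+ε n {c} {ε} 0≤ε 0≤c c[1+ε]≡1 = begin
    a ^ suc n                        ≡⟨ solve 2 (λ x y → x := y :+ (x :- y)) refl (a ^ suc n) (b ^ suc n) ⟩
    b ^ suc n + (a ^ suc n - b ^ suc n)
      ≤⟨ +-mono-≤ ([1-1/n]^n≤1÷e n) (^-difference (suc n) 0≤b b≤a a≤1) ⟩
    1# ÷ e + N * (a - b)             ≤⟨ +-mono-≤ ≤-refl slack ⟩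
    1# ÷ e + ε                       ∎
    where
    open ≤-Reasoning
    N = fromℕ (suc n)
    w = N ⁻¹
    a = 1# - c ÷ N
    b = 1# - inv n
    0≤w = ⁻¹-nonNeg (0<fromℕ-suc n)
    0≤b = x≤y⇒0≤y-x (inv-≤1 n)
    c≤1 : c ≤ 1#
    c≤1 = ≤-by (+-nonNeg (*-nonNeg 0≤c 0≤ε) (eq-nonNeg 1# (sym c[1+ε]≡1)))
      (solve 2 (λ c ε → 1: :- c := c :* ε :+ 1: :* (1: :- c :* (1: :+ ε))) refl c ε)
    b≤a : b ≤ a
    b≤a = ≤-by (*-nonNeg (x≤y⇒0≤y-x c≤1) 0≤w)
      (solve 2 (λ c w → (1: :- c :* w) :- (1: :- 1: :* w) := (1: :- c) :* w) refl c w)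
    a≤1 : a ≤ 1#
    a≤1 = ≤-by (*-nonNeg 0≤c 0≤w) (solve 2 (λ c w → 1: :- (1: :- c :* w) := c :* w) refl c w)
    slack : N * (a - b) ≤ ε
    slack = ≤-by
      (+-nonNeg (*-nonNeg 0≤ε (x≤y⇒0≤y-x c≤1))
        (+-nonNeg (eq-nonNeg (1# - c) (sym (*-inverse-pos (0<fromℕ-suc n)))) (eq-nonNeg 1# c[1+ε]≡1)))
      (solve 4 (λ c ε N w → ε :- N :* ((1: :- c :* w) :- (1: :- 1: :* w)) :=
          ε :* (1: :- c) :+ ((1: :- c) :* (1: :- N :* w) :+ 1: :* (c :* (1: :+ ε) :- 1:))) refl c ε N w)

  -- The binary logarithm

  private
    L : Carrier → Carrier → Set
    L x y = ∃[ p ] ∃[ r ] ∃[ q ] (2# ^ p ≤ 2# ^ r * x ^ suc q) × (y ≡ (fromℕ p - fromℕ r) ÷ fromℕ (suc q))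

    L-bound : ∀ k → 0# ≤ x → x ≤ 2# ^ k → UpperBound (L x) (fromℕ k)
    L-bound {x} k 0≤x x≤2^k _ (p , r , q , le , refl) = x≤y*z⇒x÷z≤y (0<fromℕ-suc q) (≤-by
      (x≤y⇒0≤y-x (subst (fromℕ p ≤_) (trans (fromℕ-+ r _) (cong (fromℕ r +_) (fromℕ-* k (suc q)))) (fromℕ-mono p≤)))
      (solve 3 (λ p r t → t :- (p :- r) := r :+ t :- p) refl (fromℕ p) (fromℕ r) _))
      where
      open ≤-Reasoning
      p≤ : p ℕ.≤ r ℕ.+ k ℕ.* suc q
      p≤ = 2^-cancel-≤ (begin
        2# ^ p                       ≤⟨ le ⟩
        2# ^ r * x ^ suc q           ≤⟨ *-monoʳ-≤ (^-nonNeg r 0≤2) (^-monoˡ-≤ (suc q) 0≤x x≤2^k) ⟩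
        2# ^ r * (2# ^ k) ^ suc q    ≡⟨ cong (2# ^ r *_) (^-assocʳ 2# k (suc q)) ⟩
        2# ^ r * 2# ^ (k ℕ.* suc q)  ≡⟨ ^-homo-* 2# r (k ℕ.* suc q) ⟨
        2# ^ (r ℕ.+ k ℕ.* suc q)     ∎)

  -- The one fact about `log₂` on which the time bound rests: logarithms occur only on its larger
  -- side, so they are to be bounded from below. `L-bound` is there because `sup` is arbitrary for
  -- an unbounded set.
  2^k≤x⇒k≤log₂ : ∀ k → 2# ^ k ≤ x → fromℕ k ≤ log₂ x
  2^k≤x⇒k≤log₂ {x} k 2^k≤x = subst (_≤ log₂ x) eq (proj₁ (sup-lub (L x) (_ , elem) bound) _ elem)
    where
    open ≤-Reasoning
    elem : L x ((fromℕ k - fromℕ 0) ÷ fromℕ 1)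
    elem = k , 0 , 0 , subst (2# ^ k ≤_) (solve 1 (λ x → x := 1: :* (x :* 1:)) refl x) 2^k≤x , refl
    bound = fromℕ (proj₁ (≤2^ x)) , L-bound (proj₁ (≤2^ x)) (≤-trans (^-nonNeg k 0≤2) 2^k≤x) (proj₂ (≤2^ x))
    eq : (fromℕ k - fromℕ 0) ÷ fromℕ 1 ≡ fromℕ k
    eq = begin-equality
      (fromℕ k - 0#) * fromℕ 1 ⁻¹          ≡⟨ solve 2 (λ k i → (k :- 0:) :* i := k :* (1: :* i)) refl (fromℕ k) (fromℕ 1 ⁻¹) ⟩
      fromℕ k * (1# * fromℕ 1 ⁻¹)          ≡⟨ cong (λ h → fromℕ k * (h * fromℕ 1 ⁻¹)) fromℕ-1 ⟨
      fromℕ k * (fromℕ 1 * fromℕ 1 ⁻¹)     ≡⟨ cong (fromℕ k *_) (*-inverse-pos (0<fromℕ-suc 0)) ⟩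
      fromℕ k * 1#                         ≡⟨ *-identityʳ _ ⟩
      fromℕ k                              ∎

-- The integer lattice

-- `χ i` is definitionally `spike i 1`, so single copies and chunks share their lemmas.
spike : ∀ {n} → Fin n → ℕ → Vec ℕ n
spike {n} i k = replicate n 0 [ i ]≔ k

private variable
  n : ℕ

⊕-identityʳ : (x : Vec ℕ n) → x ⊕ replicate n 0 ≡ x
⊕-identityʳ = Vec.zipWith-identityʳ ℕ.+-identityʳ

⊕-assoc : (x y z : Vec ℕ n) → x ⊕ y ⊕ z ≡ x ⊕ (y ⊕ z)
⊕-assoc = Vec.zipWith-assoc ℕ.+-assoc

spike-0 : (i : Fin n) → spike i 0 ≡ replicate n 0
spike-0 zero    = refl
spike-0 (suc i) = cong (0 ∷_) (spike-0 i)

⊕-spike-0 : (x : Vec ℕ n) (i : Fin n) → x ⊕ spike i 0 ≡ x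
⊕-spike-0 x i = trans (cong (x ⊕_) (spike-0 i)) (⊕-identityʳ x)

spike-+ : ∀ (i : Fin n) j k → spike i j ⊕ spike i k ≡ spike i (j ℕ.+ k)
spike-+ zero    j k = cong (j ℕ.+ k ∷_) (⊕-identityʳ _)
spike-+ (suc i) j k = cong (0 ∷_) (spike-+ i j k)

⊕-spike-+ : ∀ x (i : Fin n) j k → x ⊕ spike i j ⊕ spike i k ≡ x ⊕ spike i (j ℕ.+ k)
⊕-spike-+ x i j k = trans (⊕-assoc x _ _) (cong (x ⊕_) (spike-+ i j k))

⊕-spike-suc : ∀ x (i : Fin n) k → x ⊕ spike i (suc k) ≡ x ⊕ spike i k ⊕ χ i
⊕-spike-suc x i k = sym (trans (⊕-spike-+ x i k 1) (cong (λ h → x ⊕ spike i h) (ℕ.+-comm k 1)))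

lookup-⊕-spike : ∀ x (i : Fin n) k → lookup (x ⊕ spike i k) i ≡ lookup x i ℕ.+ k
lookup-⊕-spike {n} x i k = trans (Vec.lookup-zipWith _ i x _)
  (cong (lookup x i ℕ.+_) (Vec.lookup∘update i (replicate n 0) k))

sum-⊕ : (x y : Vec ℕ n) → Vec.sum (x ⊕ y) ≡ Vec.sum x ℕ.+ Vec.sum y
sum-⊕ []       []       = refl
sum-⊕ (a ∷ x) (b ∷ y) = trans (cong (a ℕ.+ b ℕ.+_) (sum-⊕ x y)) (interchange a b (Vec.sum x) (Vec.sum y))

sum-replicate-0 : ∀ n → Vec.sum (replicate n 0) ≡ 0
sum-replicate-0 zero    = refl
sum-replicate-0 (suc n) = sum-replicate-0 n

sum-spike : ∀ (i : Fin n) k → Vec.sum (spike i k) ≡ k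
sum-spike {suc n} zero k = trans (cong (k ℕ.+_) (sum-replicate-0 n)) (ℕ.+-identityʳ k)
sum-spike (suc i) k = sum-spike i k

sum-⊕-spike : ∀ x (i : Fin n) k → Vec.sum (x ⊕ spike i k) ≡ Vec.sum x ℕ.+ k
sum-⊕-spike x i k = trans (sum-⊕ x (spike i k)) (cong (Vec.sum x ℕ.+_) (sum-spike i k))

≼-refl : {x : Vec ℕ n} → x ≼ x
≼-refl = PW.refl ℕ.≤-refl

≼-trans : {x y z : Vec ℕ n} → x ≼ y → y ≼ z → x ≼ z
≼-trans = PW.trans ℕ.≤-trans

≼-lookup : {x y : Vec ℕ n} → x ≼ y → ∀ i → lookup x i ℕ.≤ lookup y i
≼-lookup = PW.lookup

x≼x⊕y : (x y : Vec ℕ n) → x ≼ x ⊕ y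
x≼x⊕y []       []       = []
x≼x⊕y (a ∷ x) (b ∷ y) = ℕ.m≤m+n a b ∷ x≼x⊕y x y

⊕-monoˡ-≼ : {x y : Vec ℕ n} → x ≼ y → ∀ z → x ⊕ z ≼ y ⊕ z
⊕-monoˡ-≼ []         []       = []
⊕-monoˡ-≼ (a≤b ∷ xy) (c ∷ z) = ℕ.+-monoˡ-≤ c a≤b ∷ ⊕-monoˡ-≼ xy z

replicate-0≼ : (x : Vec ℕ n) → replicate n 0 ≼ x
replicate-0≼ []      = []
replicate-0≼ (_ ∷ x) = ℕ.z≤n ∷ replicate-0≼ x

spike-mono : ∀ (i : Fin n) {j k} → j ℕ.≤ k → spike i j ≼ spike i k
spike-mono zero    j≤k = j≤k ∷ ≼-refl
spike-mono (suc i) j≤k = ℕ.z≤n ∷ spike-mono i j≤k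

⊕-spike-≼ : ∀ {x y : Vec ℕ n} (i : Fin n) k → x ≼ y → lookup x i ℕ.+ k ℕ.≤ lookup y i → x ⊕ spike i k ≼ y
⊕-spike-≼ {x = a ∷ x} zero    k (_ ∷ xy)   le = le ∷ subst (_≼ _) (sym (⊕-identityʳ x)) xy
⊕-spike-≼ {x = a ∷ x} {b ∷ _} (suc i) k (a≤b ∷ xy) le =
  subst (ℕ._≤ b) (sym (ℕ.+-identityʳ a)) a≤b ∷ ⊕-spike-≼ i k xy le

sum-mono-≼ : {x y : Vec ℕ n} → x ≼ y → Vec.sum x ℕ.≤ Vec.sum y
sum-mono-≼ []         = ℕ.z≤n
sum-mono-≼ (a≤b ∷ xy) = ℕ.+-mono-≤ a≤b (sum-mono-≼ xy)

lookup≤sum : ∀ (x : Vec ℕ n) i → lookup x i ℕ.≤ Vec.sum x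
lookup≤sum (a ∷ x) zero    = ℕ.m≤m+n a _
lookup≤sum (a ∷ x) (suc i) = ℕ.≤-trans (lookup≤sum x i) (ℕ.m≤n+m _ a)

infixl 6 _⊖_
-- Thanks to truncation `x ⊕ (y ⊖ x)` is the coordinatewise maximum of `x` and `y`.
_⊖_ : Vec ℕ n → Vec ℕ n → Vec ℕ n
_⊖_ = zipWith ℕ._∸_

y≼x⊕[y⊖x] : (x y : Vec ℕ n) → y ≼ x ⊕ (y ⊖ x)
y≼x⊕[y⊖x] []       []       = []
y≼x⊕[y⊖x] (a ∷ x) (b ∷ y) = ℕ.m≤n+m∸n b a ∷ y≼x⊕[y⊖x] x y

⊖-≼ : (y x : Vec ℕ n) → y ⊖ x ≼ y
⊖-≼ []       []       = []
⊖-≼ (b ∷ y) (a ∷ x) = ℕ.m∸n≤m b a ∷ ⊖-≼ y x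

-- DR-submodular functions on the integer lattice

module Submodular (ℝ : RealNumbers) where
  open Reals ℝ public
  open ≤-Reasoning

  -- An attained maximum is part of the approximation claim, so it is found by search: by induction
  -- on the dimension and, inside, on the bound of the first coordinate, whose topmost value leaves
  -- the budget `B ∸ suc b` to the others.
  exists-maximum : ∀ (f : Vec ℕ n → Carrier) B Bs →
    ∃[ z ] Feasible B Bs z × (∀ y → Feasible B Bs y → f y ≤ f z)
  exists-maximum f B [] = [] , ([] , ℕ.z≤n) , λ { [] _ → ≤-refl }
  exists-maximum {suc n} f B (b ∷ Bs) = first b
    where
    first : ∀ b → ∃[ z ] Feasible B (b ∷ Bs) z × (∀ y → Feasible B (b ∷ Bs) y → f y ≤ f z)
    first zero with exists-maximum (f ∘ (0 ∷_)) B Bs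
    ... | z , (z≼ , Σz≤) , max = 0 ∷ z , (ℕ.z≤n ∷ z≼ , Σz≤) ,
      λ { (_ ∷ y) (ℕ.z≤n ∷ y≼ , Σy≤) → max y (y≼ , Σy≤) }
    first (suc b) with first b | suc b ℕ.≤? B
    ... | z , z∈@(z≼ , Σz≤) , max | no b≰B = z , (≼-trans z≼ (ℕ.n≤1+n b ∷ ≼-refl) , Σz≤) , max′
      where
      max′ : ∀ y → Feasible B (suc b ∷ Bs) y → f y ≤ f z
      max′ (a ∷ y) (a≤ ∷ y≼ , Σy≤) with ℕ.m≤n⇒m<n∨m≡n a≤
      ... | inj₁ (ℕ.s≤s a≤b) = max (a ∷ y) (a≤b ∷ y≼ , Σy≤)
      ... | inj₂ refl = contradiction (ℕ.m+n≤o⇒m≤o (suc b) Σy≤) b≰B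
    ... | z , (z≼ , Σz≤) , max | yes b<B with exists-maximum (f ∘ (suc b ∷_)) (B ℕ.∸ suc b) Bs
    ... | w , (w≼ , Σw≤) , wmax = v , v∈ , max′
      where
      Σ[1+b∷y]≤B : ∀ {m} {y : Vec ℕ m} → Vec.sum y ℕ.≤ B ℕ.∸ suc b → suc b ℕ.+ Vec.sum y ℕ.≤ B
      Σ[1+b∷y]≤B {y = y} le = subst (ℕ._≤ B) (ℕ.+-comm (Vec.sum y) (suc b)) (ℕ.m≤o∸n⇒m+n≤o (Vec.sum y) b<B le)
      best : ∃[ v ] Feasible B (suc b ∷ Bs) v × f z ≤ f v × f (suc b ∷ w) ≤ f v
      best with total (f z) (f (suc b ∷ w))
      ... | inj₁ z≤w = suc b ∷ w , (ℕ.≤-refl ∷ w≼ , Σ[1+b∷y]≤B {y = w} Σw≤) , z≤w , ≤-refl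
      ... | inj₂ w≤z = z , (≼-trans z≼ (ℕ.n≤1+n b ∷ ≼-refl) , Σz≤) , ≤-refl , w≤z
      v  = proj₁ best
      v∈ = proj₁ (proj₂ best)
      max′ : ∀ y → Feasible B (suc b ∷ Bs) y → f y ≤ f v
      max′ (a ∷ y) (a≤ ∷ y≼ , Σy≤) with ℕ.m≤n⇒m<n∨m≡n a≤
      ... | inj₁ (ℕ.s≤s a≤b) = ≤-trans (max (a ∷ y) (a≤b ∷ y≼ , Σy≤)) (proj₁ (proj₂ (proj₂ best)))
      ... | inj₂ refl = ≤-trans
        (wmax y (y≼ , ℕ.m+n≤o⇒m≤o∸n (Vec.sum y) (subst (ℕ._≤ B) (ℕ.+-comm (suc b) (Vec.sum y)) Σy≤)))
        (proj₂ (proj₂ (proj₂ best)))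

  -- The form for whole chunks of one item, as needed when a vector is added coordinate by
  -- coordinate in `subadditive`.
  DiminishingReturns : (Vec ℕ n → Carrier) → Set
  DiminishingReturns f = ∀ x y → x ≼ y → ∀ i k → f (y ⊕ spike i k) - f y ≤ f (x ⊕ spike i k) - f x

  diminishingReturns : {f : Vec ℕ n → Carrier} → DRSubmodular ℝ f → DiminishingReturns f
  diminishingReturns {f = f} dr x y x≼y i zero = ≤-reflexive (begin-equality
    f (y ⊕ spike i 0) - f y   ≡⟨ cong (λ h → f h - f y) (⊕-spike-0 y i) ⟩
    f y - f y                 ≡⟨ solve 2 (λ x y → y :- y := x :- x) refl (f x) (f y) ⟩
    f x - f x                 ≡⟨ cong (λ h → f h - f x) (⊕-spike-0 x i) ⟨
    f (x ⊕ spike i 0) - f x   ∎)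
  diminishingReturns {f = f} dr x y x≼y i (suc k)
    rewrite ⊕-spike-suc x i k | ⊕-spike-suc y i k = ≤-by
    (+-nonNeg (x≤y⇒0≤y-x (dr (x ⊕ spike i k) (y ⊕ spike i k) (⊕-monoˡ-≼ x≼y _) i))
              (x≤y⇒0≤y-x (diminishingReturns {f = f} dr x y x≼y i k)))
    (solve 6 (λ a b c p q r → (a :- c) :- (p :- r) :=
        ((a :- b) :- (p :- q)) :+ ((b :- c) :- (q :- r))) refl
      (f (x ⊕ spike i k ⊕ χ i)) (f (x ⊕ spike i k)) (f x)
      (f (y ⊕ spike i k ⊕ χ i)) (f (y ⊕ spike i k)) (f y))

  concave : {f : Vec ℕ n → Carrier} → DRSubmodular ℝ f →
            ∀ x i k → f (x ⊕ spike i k) - f x ≤ fromℕ k * (f (x ⊕ χ i) - f x)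
  concave {f = f} dr x i zero = ≤-reflexive (trans (cong (λ h → f h - f x) (⊕-spike-0 x i))
    (solve 2 (λ a b → a :- a := 0: :* (b :- a)) refl (f x) (f (x ⊕ χ i))))
  concave {f = f} dr x i (suc k) rewrite ⊕-spike-suc x i k = ≤-by
    (+-nonNeg (x≤y⇒0≤y-x (dr x (x ⊕ spike i k) (x≼x⊕y x _) i)) (x≤y⇒0≤y-x (concave {f = f} dr x i k)))
    (solve 5 (λ a b c d k → (1: :+ k) :* (d :- c) :- (a :- c) :=
        ((d :- c) :- (a :- b)) :+ (k :* (d :- c) :- (b :- c))) refl
      (f (x ⊕ spike i k ⊕ χ i)) (f (x ⊕ spike i k)) (f x) (f (x ⊕ χ i)) (fromℕ k))

  -- Telescoping over the coordinates: the head chunk is added last, on top of `x ⊕ z`, where it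
  -- gains at most what it gains on top of `x`; the rest is the claim for `f ∘ (a ∷_)`. The bounds
  -- `h` are arbitrary because `saturated⇒gap` and `initial-gap` choose them differently.
  subadditive : ∀ (f : Vec ℕ n → Carrier) → DiminishingReturns f → ∀ x z (h : Vec Carrier n) →
    (∀ i → f (x ⊕ spike i (lookup z i)) - f x ≤ lookup h i) → f (x ⊕ z) - f x ≤ sum h
  subadditive f dr [] [] [] bound = ≤-reflexive (-‿inverseʳ (f []))
  subadditive f dr (a ∷ x) (b ∷ z) (c ∷ h) bound = ≤-by
    (+-nonNeg (x≤y⇒0≤y-x (≤-trans first (bound zero))) (x≤y⇒0≤y-x rest))
    (solve 6 (λ p q r s c t → c :+ t :- (p :- r) := (c :- (p :- q)) :+ (t :- (q :- r))) refl
      (f (a ℕ.+ b ∷ x ⊕ z)) (f (a ∷ x ⊕ z)) (f (a ∷ x)) 0# c (sum h))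
    where
    dr′ : DiminishingReturns (f ∘ (a ∷_))
    dr′ x y x≼y i k = subst (λ a′ → f (a′ ∷ y ⊕ spike i k) - f (a ∷ y) ≤ f (a′ ∷ x ⊕ spike i k) - f (a ∷ x))
      (ℕ.+-identityʳ a) (dr (a ∷ x) (a ∷ y) (ℕ.≤-refl ∷ x≼y) (suc i) k)
    rest : f (a ∷ x ⊕ z) - f (a ∷ x) ≤ sum h
    rest = subadditive (f ∘ (a ∷_)) dr′ x z h λ i →
      subst (λ a′ → f (a′ ∷ x ⊕ spike i (lookup z i)) - f (a ∷ x) ≤ lookup h i) (ℕ.+-identityʳ a) (bound (suc i))
    first : f (a ℕ.+ b ∷ x ⊕ z) - f (a ∷ x ⊕ z) ≤ f (a ℕ.+ b ∷ x ⊕ replicate _ 0) - f (a ∷ x)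
    first = subst (λ w → f (a ℕ.+ b ∷ w) - f (a ∷ x ⊕ z) ≤ f (a ℕ.+ b ∷ x ⊕ replicate _ 0) - f (a ∷ x))
      (⊕-identityʳ (x ⊕ z)) (dr (a ∷ x) (a ∷ x ⊕ z) (ℕ.≤-refl ∷ x≼x⊕y x z) zero b)

  sum-scaled : ∀ (z : Vec ℕ n) θ → sum (Vec.map (λ k → fromℕ k * θ) z) ≡ fromℕ (Vec.sum z) * θ
  sum-scaled []      θ = sym (zeroˡ θ)
  sum-scaled (k ∷ z) θ = trans (cong (fromℕ k * θ +_) (sum-scaled z θ))
    (trans (solve 3 (λ a b t → a :* t :+ b :* t := (a :+ b) :* t) refl (fromℕ k) (fromℕ (Vec.sum z)) θ)
      (cong (_* θ) (sym (fromℕ-+ k (Vec.sum z)))))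

  sum-≤ : ∀ (h : Vec Carrier n) u → (∀ i → lookup h i ≤ u) → sum h ≤ fromℕ n * u
  sum-≤ []      u le = ≤-reflexive (sym (zeroˡ u))
  sum-≤ {suc n} (c ∷ h) u le = subst (c + sum h ≤_)
    (solve 2 (λ n u → u :+ n :* u := (1: :+ n) :* u) refl (fromℕ n) u)
    (+-mono-≤ (le zero) (sum-≤ h u (le ∘ suc)))

  module _ {n} (f : Vec ℕ n → Carrier) (mono : Monotone ℝ f) (dr : DRSubmodular ℝ f) {B : ℕ} {Bs : Vec ℕ n} where

    Saturated : Carrier → Vec ℕ n → Fin n → Set
    Saturated θ x i = Vec.sum x ≡ B ⊎ lookup x i ≡ lookup Bs i ⊎ f (x ⊕ χ i) - f x ≤ θ

    -- This is why a pass need not return to an item: feasibility keeps a full budget or coordinate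
    -- where it is, and marginal gains only shrink.
    saturated-mono : ∀ {θ x y} → x ≼ y → Feasible B Bs y → ∀ i → Saturated θ x i → Saturated θ y i
    saturated-mono x≼y (y≼Bs , Σy≤B) i (inj₁ Σx≡B) =
      inj₁ (ℕ.≤-antisym Σy≤B (subst (ℕ._≤ _) Σx≡B (sum-mono-≼ x≼y)))
    saturated-mono x≼y (y≼Bs , Σy≤B) i (inj₂ (inj₁ xᵢ≡)) =
      inj₂ (inj₁ (ℕ.≤-antisym (≼-lookup y≼Bs i) (subst (ℕ._≤ _) xᵢ≡ (≼-lookup x≼y i))))
    saturated-mono {x = x} {y} x≼y _ i (inj₂ (inj₂ le)) = inj₂ (inj₂ (≤-trans (dr x y x≼y i) le))

    -- Every optimal increment has density at most θ once all items are saturated.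
    saturated⇒gap : ∀ {θ x} → 0# ≤ θ → Feasible B Bs x → (∀ i → Saturated θ x i) →
      ∀ o → Feasible B Bs o → Vec.sum x ≡ B ⊎ f o - f x ≤ fromℕ B * θ
    saturated⇒gap {θ} {x} 0≤θ x∈ sat o (o≼Bs , Σo≤B) with Vec.sum x ℕ.≟ B
    ... | yes full = inj₁ full
    ... | no ¬full = inj₂ (begin
      f o - f x                         ≤⟨ +-monoˡ-≤ (- f x) (mono o (x ⊕ z) (y≼x⊕[y⊖x] x o)) ⟩
      f (x ⊕ z) - f x                   ≤⟨ subadditive f (diminishingReturns {f = f} dr) x z (Vec.map (λ k → fromℕ k * θ) z) bound ⟩
      sum (Vec.map (λ k → fromℕ k * θ) z)  ≡⟨ sum-scaled z θ ⟩
      fromℕ (Vec.sum z) * θ             ≤⟨ *-monoˡ-≤ 0≤θ (fromℕ-mono (ℕ.≤-trans (sum-mono-≼ (⊖-≼ o x)) Σo≤B)) ⟩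
      fromℕ B * θ                       ∎)
      where
      z = o ⊖ x
      bound : ∀ i → f (x ⊕ spike i (lookup z i)) - f x ≤ lookup (Vec.map (λ k → fromℕ k * θ) z) i
      bound i rewrite Vec.lookup-map i (λ k → fromℕ k * θ) z with sat i
      ... | inj₁ full = contradiction full ¬full
      ... | inj₂ (inj₂ le) = ≤-trans (concave {f = f} dr x i (lookup z i)) (*-monoʳ-≤ (fromℕ-nonNeg (lookup z i)) le)
      ... | inj₂ (inj₁ xᵢ≡Bᵢ) = subst (λ k → f (x ⊕ spike i k) - f x ≤ fromℕ k * θ) (sym zᵢ≡0)
              (≤-reflexive (trans (cong (λ h → f h - f x) (⊕-spike-0 x i))
                (solve 2 (λ a t → a :- a := 0: :* t) refl (f x) θ)))
        where
        zᵢ≡0 : lookup z i ≡ 0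
        zᵢ≡0 = trans (Vec.lookup-zipWith ℕ._∸_ i o x)
          (ℕ.m≤n⇒m∸n≡0 (subst (lookup o i ℕ.≤_) (sym xᵢ≡Bᵢ) (≼-lookup o≼Bs i)))

    -- Subadditivity at the origin, followed by monotonicity in each coordinate. The caps `c` stay
    -- abstract because the program obtains the minimum of `Bᵢ` and `B` by truncated subtraction.
    initial-gap : ∀ (c : Fin n → ℕ) → (∀ i k → k ℕ.≤ lookup Bs i → k ℕ.≤ B → k ℕ.≤ c i) →
      ∀ o → Feasible B Bs o →
      f o - f (replicate n 0) ≤ sum (tabulate λ i → f (spike i (c i)) - f (replicate n 0))
    initial-gap c cap o (o≼Bs , Σo≤B) = subst (λ w → f w - f 𝟎 ≤ sum (tabulate h)) (𝟎⊕ o)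
      (subadditive f (diminishingReturns {f = f} dr) 𝟎 o (tabulate h) λ i →
        subst (f (𝟎 ⊕ spike i (lookup o i)) - f 𝟎 ≤_) (sym (Vec.lookup∘tabulate h i))
          (+-monoˡ-≤ (- f 𝟎) (subst (λ w → f w ≤ f (spike i (c i))) (sym (𝟎⊕ _))
            (mono _ _ (spike-mono i (cap i _ (≼-lookup o≼Bs i) (ℕ.≤-trans (lookup≤sum o i) Σo≤B)))))))
      where
      𝟎 = replicate n 0
      𝟎⊕ : ∀ (x : Vec ℕ n) → 𝟎 ⊕ x ≡ x
      𝟎⊕ = Vec.zipWith-identityˡ ℕ.+-identityˡ
      h : Fin n → Carrier
      h i = f (spike i (c i)) - f 𝟎

-- Approximation guarantee of the threshold passes

module Greedy (ℝ : RealNumbers) {n : ℕ} (f : Vec ℕ n → RealNumbers.Carrier ℝ)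
  (f≥0 : NonNegative ℝ f) (mono : Monotone ℝ f) (dr : DRSubmodular ℝ f) (b : ℕ) (Bs : Vec ℕ n)
  (δ : RealNumbers.Carrier ℝ) (0<δ : RealNumbers._<_ ℝ (RealNumbers.0# ℝ) δ) where

  open Submodular ℝ public
  open ≤-Reasoning

  B : ℕ
  B = suc b

  -- g is B times the density threshold.
  Step : Carrier → Vec ℕ n → Vec ℕ n → Set
  Step g x y = ∃[ i ] ∃[ k ] y ≡ x ⊕ spike i k × Feasible B Bs y × g * fromℕ k ≤ fromℕ B * (f y - f x)

  Steps : Carrier → Vec ℕ n → Vec ℕ n → Set
  Steps g = Star (Step g)

  steps⇒≼ : ∀ {g x y} → Steps g x y → x ≼ y
  steps⇒≼ Star.ε = ≼-refl
  steps⇒≼ {x = x} ((i , k , refl , _) ◅ steps) = ≼-trans (x≼x⊕y x (spike i k)) (steps⇒≼ steps)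

  Full : Carrier → Vec ℕ n → Fin n → Set
  Full g = Saturated f mono dr {B} {Bs} (g ÷ fromℕ B)

  private
    optimum = exists-maximum f B Bs

  OPT : Carrier
  OPT = f (proj₁ optimum)

  isMaximum : IsMaximum ℝ f (Feasible B Bs) OPT
  isMaximum = (proj₁ optimum , proj₁ (proj₂ optimum) , refl) , proj₂ (proj₂ optimum)

  0≤OPT : 0# ≤ OPT
  0≤OPT = f≥0 _

  0<1+δ : 0# < 1# + δ
  0<1+δ = <-≤-trans 0<1 (≤-by (proj₁ 0<δ) (solve 1 (λ d → 1: :+ d :- 1: := d) refl δ))

  private
    c : Carrier
    c = 1# ÷ (1# + δ)

    c[1+δ]≡1 : c * (1# + δ) ≡ 1#
    c[1+δ]≡1 = x÷y*y≡x 1# 0<1+δ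

    0≤c : 0# ≤ c
    0≤c = ÷-nonNeg 0≤1 0<1+δ

    w : Carrier
    w = fromℕ B ⁻¹

    0≤w : 0# ≤ w
    0≤w = ⁻¹-nonNeg (0<fromℕ-suc b)

    Bw≡1 : fromℕ B * w ≡ 1#
    Bw≡1 = *-inverse-pos (0<fromℕ-suc b)

    c÷B≤1 : c ÷ fromℕ B ≤ 1#
    c÷B≤1 = x≤y*z⇒x÷z≤y (0<fromℕ-suc b) (begin
      c               ≤⟨ x≤y*z⇒x÷z≤y 0<1+δ (≤-by (proj₁ 0<δ) (solve 1 (λ d → 1: :* (1: :+ d) :- 1: := d) refl δ)) ⟩
      1#              ≤⟨ 1≤fromℕ-suc b ⟩
      fromℕ B         ≡⟨ *-identityˡ _ ⟨
      1# * fromℕ B    ∎)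

    -- The factor by which one accepted copy is guaranteed to shrink the gap.
    ρ : Carrier
    ρ = 1# - c ÷ fromℕ B

    0≤ρ : 0# ≤ ρ
    0≤ρ = x≤y⇒0≤y-x c÷B≤1

  gap : Vec ℕ n → Carrier
  gap x = OPT - f x

  0≤gap : ∀ {x} → Feasible B Bs x → 0# ≤ gap x
  0≤gap x∈ = x≤y⇒0≤y-x (proj₂ (proj₂ optimum) _ x∈)

  -- While chunks of density g/B are added, g stays within the factor 1 + δ of the gap.
  private
    record Progress (g : Carrier) (x : Vec ℕ n) : Set where
      field
        feasible : Feasible B Bs x
        dense    : Vec.sum x ≡ B ⊎ gap x ≤ (1# + δ) * g
        decay    : gap x ≤ ρ ^ Vec.sum x * OPT
    open Progress

    -- The chunk gains at least k g / B, and g is at least `c` times the gap, so at most the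
    -- fraction 1 - k c / B of the gap is left; Bernoulli bounds this by `ρ ^ k`.
    gap-step : ∀ {g x y k} → 0# ≤ gap x → gap x ≤ (1# + δ) * g →
               g * fromℕ k ≤ fromℕ B * (f y - f x) → gap y ≤ ρ ^ k * gap x
    gap-step {g} {x} {y} {k} 0≤gap gap≤ gain = begin
      OPT - f y                             ≤⟨ ≤-by
        (+-nonNeg (*-nonNeg 0≤w (x≤y⇒0≤y-x gain))
        (+-nonNeg (*-nonNeg (*-nonNeg (*-nonNeg 0≤c 0≤w) (fromℕ-nonNeg k)) (x≤y⇒0≤y-x gap≤))
        (+-nonNeg (eq-nonNeg (f x - f y) Bw≡1) (eq-nonNeg (g * fromℕ k * w) (sym c[1+δ]≡1)))))
        (solve 9 (λ O p q g k B w c d →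
            (1: :- k :* (c :* w)) :* (O :- p) :- (O :- q) :=
            w :* (B :* (q :- p) :- g :* k) :+
            (c :* w :* k :* ((1: :+ d) :* g :- (O :- p)) :+
            ((p :- q) :* (B :* w :- 1:) :+ g :* k :* w :* (1: :- c :* (1: :+ d)))))
          refl OPT (f x) (f y) g (fromℕ k) (fromℕ B) w c δ) ⟩
      (1# - fromℕ k * (c ÷ fromℕ B)) * gap x  ≤⟨ *-monoˡ-≤ 0≤gap (1-n*x≤[1-x]^n k _ c÷B≤1) ⟩
      ρ ^ k * gap x                         ∎

    progress-step : ∀ {g x y} → Progress g x → Step g x y → Progress g y
    progress-step {g} {x} P (i , k , refl , y∈ , gain) with dense P
    -- With the budget used up, feasibility admits only an empty chunk, so nothing changes.
    ... | inj₁ full = subst (Progress g) x≡y P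
      where
      k≡0 : k ≡ 0
      k≡0 = ℕ.n≤0⇒n≡0 (ℕ.+-cancelˡ-≤ B k 0 (subst₂ ℕ._≤_
        (trans (sum-⊕-spike x i k) (cong (ℕ._+ k) full)) (sym (ℕ.+-identityʳ B)) (proj₂ y∈)))
      x≡y : x ≡ x ⊕ spike i k
      x≡y = sym (trans (cong (λ k → x ⊕ spike i k) k≡0) (⊕-spike-0 x i))
    ... | inj₂ gap≤ = record
      { feasible = y∈
      ; dense    = inj₂ (≤-trans (≤-by (x≤y⇒0≤y-x (mono x (x ⊕ spike i k) (x≼x⊕y x _)))
          (solve 3 (λ O p q → (O :- p) :- (O :- q) := q :- p) refl OPT (f x) (f (x ⊕ spike i k)))) gap≤)
      ; decay    = begin
          gap (x ⊕ spike i k)            ≤⟨ gap-step {g} {x} {x ⊕ spike i k} {k} (0≤gap (feasible P)) gap≤ gain ⟩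
          ρ ^ k * gap x                  ≤⟨ *-monoʳ-≤ (^-nonNeg k 0≤ρ) (decay P) ⟩
          ρ ^ k * (ρ ^ Vec.sum x * OPT)  ≡⟨ solve 3 (λ p q r → p :* (q :* r) := (q :* p) :* r) refl (ρ ^ k) (ρ ^ Vec.sum x) OPT ⟩
          ρ ^ Vec.sum x * ρ ^ k * OPT    ≡⟨ cong (_* OPT) (^-homo-* ρ (Vec.sum x) k) ⟨
          ρ ^ (Vec.sum x ℕ.+ k) * OPT    ≡⟨ cong (λ h → ρ ^ h * OPT) (sum-⊕-spike x i k) ⟨
          ρ ^ Vec.sum (x ⊕ spike i k) * OPT  ∎
      }

    progress-steps : ∀ {g x y} → Progress g x → Steps g x y → Progress g y
    progress-steps P Star.ε              = P
    progress-steps P (step ◅ steps) = progress-steps (progress-step P step) steps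

  -- The invariant of the outer loop.
  record Good (g : Carrier) (x : Vec ℕ n) : Set where
    field
      feasible : Feasible B Bs x
      nonNeg   : 0# ≤ g
      bounded  : Vec.sum x ≡ B ⊎ gap x ≤ g
      decay    : gap x ≤ ρ ^ Vec.sum x * OPT

  -- The old bound gap ≤ g is gap ≤ (1 + δ) g' for the new g', which starts `Progress`; saturation
  -- at the end of the pass restores gap ≤ g'.
  good-pass : ∀ {g x y} → Good g x → Steps (g ÷ (1# + δ)) x y → (∀ i → Full (g ÷ (1# + δ)) y i) →
              Good (g ÷ (1# + δ)) y
  good-pass {g} {x} {y} G steps full = record
    { feasible = Progress.feasible P
    ; nonNeg   = 0≤g′
    ; bounded  = subst (λ h → Vec.sum y ≡ B ⊎ gap y ≤ h) (trans (*-comm (fromℕ B) _) (x÷y*y≡x g′ (0<fromℕ-suc b)))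
                   (saturated⇒gap f mono dr (÷-nonNeg 0≤g′ (0<fromℕ-suc b)) (Progress.feasible P) full
                     (proj₁ optimum) (proj₁ (proj₂ optimum)))
    ; decay    = Progress.decay P
    }
    where
    module G = Good G
    g′ = g ÷ (1# + δ)
    0≤g′ = ÷-nonNeg G.nonNeg 0<1+δ
    P : Progress g′ y
    P = progress-steps record
      { feasible = G.feasible
      ; dense    = subst (λ h → Vec.sum x ≡ B ⊎ gap x ≤ h) (sym (trans (*-comm _ g′) (x÷y*y≡x g 0<1+δ))) G.bounded
      ; decay    = G.decay
      } steps

  good-initial : ∀ {g} → gap (replicate n 0) ≤ g → Good g (replicate n 0)
  good-initial gap≤ = record
    { feasible = 𝟎∈
    ; nonNeg   = ≤-trans (0≤gap 𝟎∈) gap≤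
    ; bounded  = inj₂ gap≤
    ; decay    = subst (λ h → gap (replicate n 0) ≤ ρ ^ h * OPT) (sym (sum-replicate-0 n))
        (≤-by (f≥0 _) (solve 2 (λ O p → 1: :* O :- (O :- p) := p) refl OPT (f (replicate n 0))))
    }
    where
    𝟎∈ : Feasible B Bs (replicate n 0)
    𝟎∈ = replicate-0≼ Bs , subst (ℕ._≤ B) (sym (sum-replicate-0 n)) ℕ.z≤n

  gap⇒approximates : ∀ {g x} → Good g x → gap x ≤ δ * OPT → Approximates ℝ δ B Bs f x
  gap⇒approximates {g} {x} G gap≤ = Good.feasible G , OPT , isMaximum , ≤-by
    (+-nonNeg (x≤y⇒0≤y-x gap≤) (*-nonNeg 0≤1÷e 0≤OPT))
    (solve 4 (λ O p d u → p :- (1: :- u :- d) :* O := d :* O :- (O :- p) :+ u :* O) refl OPT (f x) δ (1# ÷ e))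

  full⇒approximates : ∀ {g x} → Good g x → Vec.sum x ≡ B → Approximates ℝ δ B Bs f x
  full⇒approximates {g} {x} G full = Good.feasible G , OPT , isMaximum , ≤-by
    (+-nonNeg (x≤y⇒0≤y-x (subst (λ h → gap x ≤ ρ ^ h * OPT) full (Good.decay G)))
      (*-nonNeg (x≤y⇒0≤y-x ([1-c/n]^n≤1÷e+ε b (proj₁ 0<δ) 0≤c c[1+δ]≡1)) 0≤OPT))
    (solve 5 (λ O p d u r → p :- (1: :- u :- d) :* O := (r :* O :- (O :- p)) :+ (u :+ d :- r) :* O) refl
      OPT (f x) δ (1# ÷ e) (ρ ^ B))

-- Boolean tests, sums over ranges and integer logarithms

∧-true : ∀ {a b} → a ∧ b ≡ true → a ≡ true × b ≡ true
∧-true {true} eq = refl , eq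

∧-false : ∀ {a b} → a ∧ b ≡ false → a ≡ false ⊎ b ≡ false
∧-false {true}  eq = inj₂ eq
∧-false {false} eq = inj₁ refl

≤ᵇ-true : ∀ {m n} → (m ≤ᵇ n) ≡ true → m ℕ.≤ n
≤ᵇ-true {m} {n} eq = ℕ.≤ᵇ⇒≤ m n (subst T (sym eq) tt)

≤ᵇ-false : ∀ {m n} → (m ≤ᵇ n) ≡ false → n ℕ.< m
≤ᵇ-false {m} {n} eq = ℕ.≰⇒> λ m≤n → subst T eq (ℕ.≤⇒≤ᵇ m≤n)

<⇒≤ᵇ-false : ∀ {m n} → n ℕ.< m → (m ≤ᵇ n) ≡ false
<⇒≤ᵇ-false {m} {n} n<m with m ≤ᵇ n in eq
... | false = refl
... | true  = contradiction (≤ᵇ-true eq) (ℕ.<⇒≱ n<m)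

does-true : ∀ {P : Set} (P? : Dec P) → does P? ≡ true → P
does-true (yes p) _ = p

does-false : ∀ {P : Set} (P? : Dec P) → does P? ≡ false → ¬ P
does-false (no ¬p) _ = ¬p

module RangeSum {A : Set} (_∙_ : A → A → A) (ι : A) where

  -- Start and length correspond to the item counter of a loop and to its remaining iterations. The
  -- monoid is a parameter since both step counts and the initial estimate are such sums.
  sumFrom : (ℕ → A) → ℕ → ℕ → A
  sumFrom h i zero    = ι
  sumFrom h i (suc d) = h i ∙ sumFrom h (suc i) d

  sumFrom-suc : ∀ h i d → sumFrom h (suc i) d ≡ sumFrom (h ∘ suc) i d
  sumFrom-suc h i zero    = refl
  sumFrom-suc h i (suc d) = cong (h (suc i) ∙_) (sumFrom-suc h (suc i) d)

  sumFrom-tabulate : ∀ n (h : ℕ → A) → sumFrom h 0 n ≡ Vec.foldr′ _∙_ ι (tabulate {n = n} (h ∘ toℕ))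
  sumFrom-tabulate zero    h = refl
  sumFrom-tabulate (suc n) h = cong (h 0 ∙_) (trans (sumFrom-suc h 0 n) (sumFrom-tabulate n (h ∘ suc)))

open RangeSum ℕ._+_ 0 using () renaming (sumFrom to sumFromⁿ; sumFrom-suc to sumFromⁿ-suc) public

-- lg k is the integer part of log₂ k.
lg : ℕ → ℕ
lg zero          = 0
lg (suc zero)    = 0
lg (suc (suc k)) = if 2 ℕ.^ suc (lg (suc k)) ≤ᵇ suc (suc k) then suc (lg (suc k)) else lg (suc k)

lg-bounds : ∀ k → 2 ℕ.^ lg (suc k) ℕ.≤ suc k × suc k ℕ.< 2 ℕ.^ suc (lg (suc k))
lg-bounds zero = ℕ.s≤s ℕ.z≤n , ℕ.s≤s (ℕ.s≤s ℕ.z≤n)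
lg-bounds (suc k) with lg-bounds k | 2 ℕ.^ suc (lg (suc k)) ≤ᵇ suc (suc k) in eq
... | lower , upper | true  = ≤ᵇ-true eq , ℕ.≤-<-trans upper (ℕ.^-monoʳ-< 2 (ℕ.s≤s (ℕ.s≤s ℕ.z≤n)) (ℕ.n<1+n (suc (lg (suc k)))))
... | lower , upper | false = ℕ.m≤n⇒m≤1+n lower , ≤ᵇ-false eq

-- Arrays as vectors

update-updates : ∀ {A : Set} (a : ℕ → A) k v → update a k v k ≡ v
update-updates a k v with k ≡ᵇ k | ℕ.≡⇒≡ᵇ k k refl
... | true | _ = refl

update-minimal : ∀ {A : Set} (a : ℕ → A) {j k} v → j ≢ k → update a k v j ≡ a j
update-minimal a {j} {k} v j≢k with j ≡ᵇ k in eq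
... | false = refl
... | true  = contradiction (ℕ.≡ᵇ⇒≡ j k (subst T (sym eq) tt)) j≢k

-- A rejected chunk, added tentatively for the query, is subtracted again; this restores the array.
update-undo : ∀ (a : ℕ → ℕ) k p j →
  update (update a k (a k ℕ.+ p)) k (update a k (a k ℕ.+ p) k ℕ.∸ p) j ≡ a j
update-undo a k p j with j ℕ.≟ k
... | yes refl = trans (update-updates (update a k (a k ℕ.+ p)) k _)
                   (trans (cong (ℕ._∸ p) (update-updates a k (a k ℕ.+ p))) (ℕ.m+n∸n≡m (a k) p))
... | no  j≢k  = trans (update-minimal (update a k _) _ j≢k) (update-minimal a _ j≢k)

cells : (n : ℕ) → (ℕ → ℕ) → Vec ℕ n
cells n a = tabulate (a ∘ toℕ)

cells-update : ∀ {n} (i : Fin n) (a : ℕ → ℕ) p →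
  cells n (update a (toℕ i) (a (toℕ i) ℕ.+ p)) ≡ cells n a ⊕ spike i p
cells-update {suc n} zero    a p = cong (a 0 ℕ.+ p ∷_) (sym (⊕-identityʳ _))
cells-update {suc n} (suc i) a p = cong₂ _∷_ (sym (ℕ.+-identityʳ (a 0))) (cells-update i (a ∘ suc) p)

cells-0 : ∀ {n} {a : ℕ → ℕ} → (∀ j → a j ≡ 0) → cells n a ≡ replicate n 0
cells-0 {zero}  a≡0 = refl
cells-0 {suc n} a≡0 = cong₂ _∷_ (a≡0 0) (cells-0 (a≡0 ∘ suc))

-- Natural-number registers: 0 = n, 1 = B, 2 = current item, 3 = used budget, 4 = level.
-- Real registers: 0 = ε, 1 = g, 2 = initial g, 3 = current value, 4 = probed value.
-- Arrays: 0 = current vector, 1 = the Bᵢ, 2 = powers of two.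

estimateBody : Program
estimateBody =
  -- Subtracting the excess over `B` leaves the largest feasible number of copies of this item
  -- alone.
  0 ⟨ reg 2 ⟩≔ⁿ 1 ⟨ reg 2 ⟩ ∸ (1 ⟨ reg 2 ⟩ ∸ reg 1) ⨾
  query 4 0 ⨾
  0 ⟨ reg 2 ⟩≔ⁿ lit 0 ⨾
  2 ≔ʳ reg 2 ∔ (reg 4 − reg 3) ⨾
  2 ≔ⁿ reg 2 ∔ lit 1

moreItems : BoolExp
moreItems = reg 2 ∔ lit 1 ≤ⁿ reg 0

-- Programs can neither halve nor exponentiate, so the powers of two are tabulated by doubling and
-- then read backwards.
doublingGuard : BoolExp
doublingGuard = 2 ⟨ reg 4 ⟩ ≤ⁿ 1 ⟨ reg 2 ⟩

doublingBody : Program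
doublingBody =
  2 ⟨ reg 4 ∔ lit 1 ⟩≔ⁿ 2 ⟨ reg 4 ⟩ ∔ 2 ⟨ reg 4 ⟩ ⨾
  4 ≔ⁿ reg 4 ∔ lit 1

descentGuard : BoolExp
descentGuard = lit 1 ≤ⁿ reg 4

-- Evaluated while the chunk is in the vector tentatively: the cell of the item already counts it,
-- the used budget in register 3 does not.
acceptable : BoolExp
acceptable =
  0 ⟨ reg 2 ⟩ ≤ⁿ 1 ⟨ reg 2 ⟩ &
  reg 3 ∔ 2 ⟨ reg 4 ⟩ ≤ⁿ reg 1 &
  reg 1 ∗ real (2 ⟨ reg 4 ⟩) ≤ʳ real (reg 1) ∗ (reg 4 − reg 3)

descentBody : Program
descentBody =
  4 ≔ⁿ reg 4 ∸ lit 1 ⨾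
  0 ⟨ reg 2 ⟩≔ⁿ 0 ⟨ reg 2 ⟩ ∔ 2 ⟨ reg 4 ⟩ ⨾
  query 4 0 ⨾
  (IF acceptable
   THEN 3 ≔ⁿ reg 3 ∔ 2 ⟨ reg 4 ⟩ ⨾ 3 ≔ʳ reg 4
   ELSE 0 ⟨ reg 2 ⟩≔ⁿ 0 ⟨ reg 2 ⟩ ∸ 2 ⟨ reg 4 ⟩)

itemBody : Program
itemBody =
  2 ⟨ lit 0 ⟩≔ⁿ lit 1 ⨾
  4 ≔ⁿ lit 0 ⨾
  (WHILE doublingGuard DO doublingBody) ⨾
  (WHILE descentGuard DO descentBody) ⨾
  2 ≔ⁿ reg 2 ∔ lit 1

-- The exit condition n g ≤ ε g₀ together with g₀ ≤ n OPT yields g ≤ ε OPT for n > 0, without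
-- knowledge of OPT.
passGuard : BoolExp
passGuard = ¬ᵇ (real (reg 0) ∗ reg 1 ≤ʳ reg 0 ∗ reg 2)

passBody : Program
passBody =
  1 ≔ʳ reg 1 ∕ (real (lit 1) ∔ reg 0) ⨾
  2 ≔ⁿ lit 0 ⨾
  (WHILE moreItems DO itemBody)

greedy : Program
greedy =
  query 3 0 ⨾
  (WHILE moreItems DO estimateBody) ⨾
  1 ≔ʳ reg 2 ⨾
  (WHILE passGuard DO passBody)

-- Total correctness with a bound on the number of steps

module Hoare (ℝ : RealNumbers) {n : ℕ} (f : Vec ℕ n → RealNumbers.Carrier ℝ) where
  open Semantics ℝ

  Runs : Program → State → (State → Set) → ℕ → Set
  Runs p s Q τ = ∃[ s′ ] ∃[ t ] Exec f p s s′ t × t ℕ.≤ τ × Q s′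

  -- I d is the invariant with at most d iterations to go, cost d the time these take.
  while-rule : ∀ {b p} (I : ℕ → State → Set) (cost : ℕ → ℕ) →
    (∀ d → suc (costᵇ b) ℕ.≤ cost d) →
    (∀ {s} → I 0 s → evalᵇ b s ≡ false) →
    (∀ {d s} → I (suc d) s → evalᵇ b s ≡ true →
      ∃[ τ ] suc (costᵇ b ℕ.+ (τ ℕ.+ cost d)) ℕ.≤ cost (suc d) × Runs p s (I d) τ) →
    ∀ d {s} → I d s → Runs (WHILE b DO p) s (λ s′ → ∃[ d′ ] I d′ s′ × evalᵇ b s′ ≡ false) (cost d)
  while-rule {b} I cost exit stop step d {s} inv with evalᵇ b s in eq
  while-rule {b} I cost exit stop step d       {s} inv | false = s , _ , while-false eq , exit d , d , inv , eq
  while-rule {b} I cost exit stop step zero    {s} inv | true  = contradiction (trans (sym eq) (stop inv)) λ ()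
  while-rule {b} I cost exit stop step (suc d) {s} inv | true with step inv eq
  ... | τ , bound , s′ , t , exec , t≤ , inv′ with while-rule I cost exit stop step d inv′
  ... | s″ , u , exec′ , u≤ , post = s″ , _ , while-true eq exec exec′ ,
    ℕ.≤-trans (ℕ.s≤s (ℕ.+-monoʳ-≤ (costᵇ b) (ℕ.+-mono-≤ t≤ u≤))) bound , post

-- Correctness and step count of the program

module Verification (ℝ : RealNumbers) {n : ℕ} (f : Vec ℕ n → RealNumbers.Carrier ℝ)
  (f≥0 : NonNegative ℝ f) (mono : Monotone ℝ f) (dr : DRSubmodular ℝ f) (b : ℕ) (Bs : Vec ℕ n)
  (Bs>0 : ∀ i → 0 ℕ.< lookup Bs i)
  (δ : RealNumbers.Carrier ℝ) (0<δ : RealNumbers._<_ ℝ (RealNumbers.0# ℝ) δ) where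

  open Greedy ℝ f f≥0 mono dr b Bs δ 0<δ
  open Semantics ℝ
  open Hoare ℝ f

  toArray-lookup : ∀ {m} (v : Vec ℕ m) i → toArray v (toℕ i) ≡ lookup v i
  toArray-lookup (_ ∷ v) zero    = refl
  toArray-lookup (_ ∷ v) (suc i) = toArray-lookup v i

  -- A product rather than a record, so that assignments to other cells
  -- preserve it definitionally.
  Core : Carrier → Carrier → Vec ℕ n → State → Set
  Core g₀ g x s =
    natReg s 0 ≡ n × natReg s 1 ≡ B × natArr s 1 ≡ toArray Bs × realReg s 0 ≡ δ × realReg s 2 ≡ g₀ ×
    realReg s 1 ≡ g × readVec n 0 s ≡ x × natReg s 3 ≡ Vec.sum x × realReg s 3 ≡ f x × Feasible B Bs x

  core-feasible : ∀ {g₀ g x s} → Core g₀ g x s → Feasible B Bs x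
  core-feasible (_ , _ , _ , _ , _ , _ , _ , _ , _ , x∈) = x∈

  -- Failure of `acceptable` for p copies, with the density clause in the weak form that halving
  -- preserves and `Full` asks for.
  Rejected : Carrier → Vec ℕ n → Fin n → ℕ → Set
  Rejected g x i p = lookup Bs i ℕ.< lookup x i ℕ.+ p ⊎ B ℕ.< Vec.sum x ℕ.+ p ⊎
    fromℕ B * (f (x ⊕ spike i p) - f x) ≤ g * fromℕ p

  Powers : ℕ → State → Set
  Powers j s = ∀ k → k ℕ.≤ j → natArr s 2 k ≡ 2 ℕ.^ k

  -- Opaque, since unfolding the numerals makes normal forms explode.
  opaque
    itemCost : ℕ → ℕ
    itemCost l = 100 ℕ.* suc l

    -- The summands: 5 for initialisation, at most `suc l` doublings at 19 steps with the exit
    -- rounded up to 19, at most `suc l` descents at 49 steps with an exit of 4, and 4 for the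
    -- increment.
    item-time : ∀ l → 5 ℕ.+ (suc (suc l) ℕ.* 19 ℕ.+ (suc l ℕ.* 49 ℕ.+ 4 ℕ.+ 4)) ℕ.≤ itemCost l
    item-time l = begin
      5 ℕ.+ (suc (suc l) ℕ.* 19 ℕ.+ (suc l ℕ.* 49 ℕ.+ 4 ℕ.+ 4))
        ≡⟨ solveⁿ 1 (λ l → conⁿ 5 :+ⁿ ((conⁿ 1 :+ⁿ l) :*ⁿ conⁿ 19 :+ⁿ (l :*ⁿ conⁿ 49 :+ⁿ conⁿ 4 :+ⁿ conⁿ 4)) :=ⁿ conⁿ 32 :+ⁿ conⁿ 68 :*ⁿ l) refl (suc l) ⟩
      32 ℕ.+ 68 ℕ.* suc l
        ≤⟨ ℕ.+-monoˡ-≤ (68 ℕ.* suc l) (ℕ.*-monoʳ-≤ 32 (ℕ.s≤s (ℕ.z≤n {l}))) ⟩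
      32 ℕ.* suc l ℕ.+ 68 ℕ.* suc l
        ≡⟨ ℕ.*-distribʳ-+ (suc l) 32 68 ⟨
      100 ℕ.* suc l ∎
      where open ℕ.≤-Reasoning

  module _ (g₀ g : Carrier) (i : Fin n) where

    doublingCost : ℕ → ℕ
    doublingCost d = suc d ℕ.* 19

    Doubling : Vec ℕ n → ℕ → State → Set
    Doubling x d s = Core g₀ g x s × natReg s 2 ≡ toℕ i × Powers (natReg s 4) s × natReg s 4 ℕ.+ d ≡ suc (lg (lookup Bs i))

    private
      current-bound : ∀ {x s} → Core g₀ g x s → natReg s 2 ≡ toℕ i → natArr s 1 (natReg s 2) ≡ lookup Bs i
      current-bound (_ , _ , Bs≡ , _) i≡ = trans (cong₂ (λ a j → a j) Bs≡ i≡) (toArray-lookup Bs i)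

      lookup-Bs< : lookup Bs i ℕ.< 2 ℕ.^ suc (lg (lookup Bs i))
      lookup-Bs< with lookup Bs i | Bs>0 i
      ... | suc k | _ = proj₂ (lg-bounds k)

    doubling : ∀ x d {s} → Doubling x d s → Runs (WHILE doublingGuard DO doublingBody) s
      (λ s′ → ∃[ d′ ] Doubling x d′ s′ × evalᵇ doublingGuard s′ ≡ false) (doublingCost d)
    doubling x = while-rule (Doubling x) doublingCost
      (λ d → ℕ.≤-trans (ℕ.≤ᵇ⇒≤ 6 19 tt) (ℕ.m≤m+n 19 (d ℕ.* 19)))
      -- At d = 0 the last tabulated power is 2^(1 + lg Bᵢ), which exceeds `Bᵢ`.
      (λ {s} (core , i≡ , pow , j≡) → <⇒≤ᵇ-false (subst₂ ℕ._<_ (sym (current-bound {x} {s} core i≡))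
        (sym (trans (pow _ ℕ.≤-refl) (cong (2 ℕ.^_) (trans (sym (ℕ.+-identityʳ _)) j≡)))) lookup-Bs<))
      λ {d} {s} (core , i≡ , pow , j≡) _ → 13 , ℕ.≤-refl , _ , _ , seq storeⁿ assignⁿ , ℕ.≤-refl ,
        core , i≡ , extend s pow , trans (ℕ.+-assoc (natReg s 4) 1 d) j≡
      where
      extend : ∀ s → Powers (natReg s 4) s → ∀ k → k ℕ.≤ natReg s 4 ℕ.+ 1 →
        update (natArr s 2) (natReg s 4 ℕ.+ 1) (natArr s 2 (natReg s 4) ℕ.+ natArr s 2 (natReg s 4)) k ≡ 2 ℕ.^ k
      extend s pow k k≤ with k ℕ.≟ natReg s 4 ℕ.+ 1
      ... | yes refl = trans (update-updates (natArr s 2) k _)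
              (trans (cong (λ h → h ℕ.+ h) (pow j ℕ.≤-refl))
              (trans (cong (2 ℕ.^ j ℕ.+_) (sym (ℕ.+-identityʳ _))) (cong (2 ℕ.^_) (ℕ.+-comm 1 j))))
              where j = natReg s 4
      ... | no k≢ = trans (update-minimal (natArr s 2) _ k≢)
              (pow k (ℕ.s≤s⁻¹ (subst (suc k ℕ.≤_) (ℕ.+-comm _ 1) (ℕ.≤∧≢⇒< k≤ k≢))))

    descentCost : ℕ → ℕ
    descentCost d = d ℕ.* 49 ℕ.+ 4

    Descent : Vec ℕ n → ℕ → State → Set
    Descent x₀ d s = ∃[ x ] Core g₀ g x s × natReg s 2 ≡ toℕ i × natReg s 4 ≡ d × (∀ k → k ℕ.< d → natArr s 2 k ≡ 2 ℕ.^ k) ×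
      Rejected g x i (2 ℕ.^ d) × Steps g x₀ x

    -- Of the at most 2 g p / B that 2 p copies gain, the first p take at least g p / B, which
    -- leaves at most g p / B for the second p. In the other two cases p copies merely move into the
    -- vector. The sum `p ℕ.+ (p ℕ.+ 0)` is what 2^(d+1) unfolds to.
    rejected-halve : ∀ x p → g * fromℕ p ≤ fromℕ B * (f (x ⊕ spike i p) - f x) →
      Rejected g x i (p ℕ.+ (p ℕ.+ 0)) → Rejected g (x ⊕ spike i p) i p
    rejected-halve x p gain rejected rewrite ℕ.+-identityʳ p with rejected
    ... | inj₁ lt = inj₁ (subst (lookup Bs i ℕ.<_)
            (trans (sym (ℕ.+-assoc _ p p)) (cong (ℕ._+ p) (sym (lookup-⊕-spike x i p)))) lt)
    ... | inj₂ (inj₁ lt) = inj₂ (inj₁ (subst (B ℕ.<_)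
            (trans (sym (ℕ.+-assoc _ p p)) (cong (ℕ._+ p) (sym (sum-⊕-spike x i p)))) lt))
    ... | inj₂ (inj₂ le) = inj₂ (inj₂ (subst (λ y → fromℕ B * (f y - f x′) ≤ g * fromℕ p) (sym (⊕-spike-+ x i p p)) (≤-by
            (+-nonNeg (x≤y⇒0≤y-x le) (+-nonNeg (x≤y⇒0≤y-x gain) (eq-nonNeg g (sym (fromℕ-+ p p)))))
            (solve 7 (λ B g p pp a b c → g :* p :- B :* (a :- b) :=
                (g :* pp :- B :* (a :- c)) :+ ((B :* (b :- c) :- g :* p) :+ g :* (p :+ p :- pp)))
              refl (fromℕ B) g (fromℕ p) (fromℕ (p ℕ.+ p)) (f (x ⊕ spike i (p ℕ.+ p))) (f x′) (f x)))))
      where x′ = x ⊕ spike i p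

    descent-step : ∀ {x₀ d s} → Descent x₀ (suc d) s → Runs descentBody s (Descent x₀ d) 45
    descent-step {x₀} {d} {s} (x , core@(n≡ , B≡ , Bs≡ , δ≡ , g₀≡ , g≡ , x≡ , used≡ , value≡ , x≼Bs , Σx≤B) ,
                               i≡ , j≡ , pow , rejected , steps) = decide _ refl
      where
      k = natReg s 2
      P = natArr s 2 (natReg s 4 ℕ.∸ 1)
      p = 2 ℕ.^ d
      x′ = x ⊕ spike i p
      s₁ = setNatReg 4 (natReg s 4 ℕ.∸ 1) s
      s₂ = setNatArr 0 k (natArr s 0 k ℕ.+ P) s₁
      s₃ = setRealReg 4 (f (readVec n 0 s₂)) s₂
      level≡ : natReg s 4 ℕ.∸ 1 ≡ d
      level≡ = cong (ℕ._∸ 1) j≡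
      p≡ : P ≡ p
      p≡ = trans (cong (natArr s 2) level≡) (pow d ℕ.≤-refl)
      x′≡ : readVec n 0 s₂ ≡ x′
      x′≡ = trans (cong₂ (λ k P → cells n (update (natArr s 0) k (natArr s 0 k ℕ.+ P))) i≡ p≡)
        (trans (cells-update i (natArr s 0) p) (cong (_⊕ spike i p) x≡))
      cell≡ : natArr s₂ 0 k ≡ lookup x i ℕ.+ p
      cell≡ = trans (update-updates (natArr s 0) k _) (cong₂ ℕ._+_
        (trans (cong (natArr s 0) i≡) (trans (sym (Vec.lookup∘tabulate _ i)) (cong (λ v → lookup v i) x≡))) p≡)
      bound≡ : natArr s 1 k ≡ lookup Bs i
      bound≡ = current-bound {x} {s} core i≡
      total≡ : natReg s 3 ℕ.+ P ≡ Vec.sum x ℕ.+ p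
      total≡ = cong₂ ℕ._+_ used≡ p≡
      lhs≡ : realReg s 1 * fromℕ P ≡ g * fromℕ p
      lhs≡ = cong₂ (λ g P → g * fromℕ P) g≡ p≡
      rhs≡ : fromℕ (natReg s 1) * (f (readVec n 0 s₂) - realReg s 3) ≡ fromℕ B * (f x′ - f x)
      rhs≡ = cong₂ _*_ (cong fromℕ B≡) (cong₂ _-_ (cong f x′≡) value≡)
      density? = realReg s 1 * fromℕ P ≤? fromℕ (natReg s 1) * (f (readVec n 0 s₂) - realReg s 3)
      pow′ : ∀ j → j ℕ.< d → natArr s 2 j ≡ 2 ℕ.^ j
      pow′ j j<d = pow j (ℕ.m≤n⇒m≤1+n j<d)

      decide : ∀ a → evalᵇ acceptable s₃ ≡ a → Runs descentBody s (Descent x₀ d) 45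
      decide true acc with ∧-true {natArr s₂ 0 k ≤ᵇ natArr s 1 k} acc
      ... | fits , acc′ with ∧-true {natReg s 3 ℕ.+ P ≤ᵇ natReg s 1} acc′
      ... | within , dense = _ , _ , seq assignⁿ (seq storeⁿ (seq query (if-true acc (seq assignⁿ assignʳ)))) , ℕ.≤-refl ,
        x′ , (n≡ , B≡ , Bs≡ , δ≡ , g₀≡ , g≡ , x′≡ , trans total≡ (sym (sum-⊕-spike x i p)) , cong f x′≡ , x′∈) ,
        i≡ , level≡ , pow′ , rejected-halve x p gain rejected , steps ◅◅ ((i , p , refl , x′∈ , gain) ◅ Star.ε)
        where
        x′∈ : Feasible B Bs x′
        x′∈ = ⊕-spike-≼ i p x≼Bs (subst₂ ℕ._≤_ cell≡ bound≡ (≤ᵇ-true fits)) ,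
          subst₂ ℕ._≤_ (trans total≡ (sym (sum-⊕-spike x i p))) B≡ (≤ᵇ-true within)
        gain : g * fromℕ p ≤ fromℕ B * (f x′ - f x)
        gain = subst₂ _≤_ lhs≡ rhs≡ (does-true density? dense)
      -- Undoing the chunk takes 7 steps, exactly as many as the bookkeeping of an accepted one, so
      -- 45 fits both branches.
      decide false rej = _ , _ , seq assignⁿ (seq storeⁿ (seq query (if-false rej storeⁿ))) , ℕ.≤-refl ,
        x , (n≡ , B≡ , Bs≡ , δ≡ , g₀≡ , g≡ , trans (Vec.tabulate-cong (update-undo (natArr s 0) k P ∘ toℕ)) x≡ ,
             used≡ , value≡ , x≼Bs , Σx≤B) ,
        i≡ , level≡ , pow′ , reason (∧-false {natArr s₂ 0 k ≤ᵇ natArr s 1 k} rej) , steps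
        where
        reason : (natArr s₂ 0 k ≤ᵇ natArr s 1 k) ≡ false ⊎
                 ((natReg s 3 ℕ.+ P ≤ᵇ natReg s 1) ∧ does density?) ≡ false → Rejected g x i p
        reason (inj₁ eq) = inj₁ (subst₂ ℕ._<_ bound≡ cell≡ (≤ᵇ-false eq))
        reason (inj₂ eq) with ∧-false {natReg s 3 ℕ.+ P ≤ᵇ natReg s 1} eq
        ... | inj₁ eq′ = inj₂ (inj₁ (subst₂ ℕ._<_ B≡ total≡ (≤ᵇ-false eq′)))
        ... | inj₂ eq′ = inj₂ (inj₂ (subst₂ _≤_ rhs≡ lhs≡ (≰⇒≥ (does-false density? eq′))))

    descent : ∀ x₀ d {s} → Descent x₀ d s → Runs (WHILE descentGuard DO descentBody) s
      (λ s′ → ∃[ d′ ] Descent x₀ d′ s′ × evalᵇ descentGuard s′ ≡ false) (descentCost d)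
    descent x₀ = while-rule (Descent x₀) descentCost
      (λ d → ℕ.m≤n+m 4 (d ℕ.* 49))
      (λ { (_ , _ , _ , j≡ , _) → <⇒≤ᵇ-false (subst (ℕ._< 1) (sym j≡) (ℕ.s≤s ℕ.z≤n)) })
      (λ inv _ → 45 , ℕ.≤-refl , descent-step inv)

    -- Level 0 of the descent has chunks of a single copy.
    rejected⇒full : ∀ {x} → Feasible B Bs x → Rejected g x i 1 → Full g x i
    rejected⇒full {x} (x≼Bs , _) (inj₁ lt) =
      inj₂ (inj₁ (ℕ.≤-antisym (≼-lookup x≼Bs i) (ℕ.s≤s⁻¹ (subst (lookup Bs i ℕ.<_) (ℕ.+-comm _ 1) lt))))
    rejected⇒full {x} (_ , Σx≤B) (inj₂ (inj₁ lt)) =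
      inj₁ (ℕ.≤-antisym Σx≤B (ℕ.s≤s⁻¹ (subst (B ℕ.<_) (ℕ.+-comm _ 1) lt)))
    rejected⇒full {x} _ (inj₂ (inj₂ le)) =
      inj₂ (inj₂ (x*z≤y⇒x≤y÷z (0<fromℕ-suc b) (subst₂ _≤_ (*-comm _ _) (trans (cong (g *_) fromℕ-1) (*-identityʳ g)) le)))

    item-step : ∀ {x s} → Core g₀ g x s → natReg s 2 ≡ toℕ i → Runs itemBody s
      (λ s′ → ∃[ y ] Core g₀ g y s′ × natReg s′ 2 ≡ suc (natReg s 2) × Steps g x y × Full g y i)
      (itemCost (lg (lookup Bs i)))
    item-step {x} {s} core i≡
      with doubling x (suc (lg (lookup Bs i))) {setNatReg 4 0 (setNatArr 2 0 1 s)} (core , i≡ , (λ { zero ℕ.z≤n → refl }) , refl)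
    ... | s₁ , t₁ , exec₁ , t₁≤ , d₁ , (core₁ , i≡₁ , pow₁ , j≡₁) , guard₁
      -- The descent starts from a power of two above `Bᵢ`, which is rejected by the bound of the
      -- item alone.
      with descent x (natReg s₁ 4) {s₁} (x , core₁ , i≡₁ , refl , (λ k k< → pow₁ k (ℕ.<⇒≤ k<)) , inj₁ too-big , Star.ε)
      where
      too-big : lookup Bs i ℕ.< lookup x i ℕ.+ 2 ℕ.^ natReg s₁ 4
      too-big = ℕ.≤-trans (subst₂ ℕ._<_ (current-bound {x} {s₁} core₁ i≡₁) (pow₁ _ ℕ.≤-refl) (≤ᵇ-false guard₁)) (ℕ.m≤n+m _ _)
    ... | s₂ , t₂ , exec₂ , t₂≤ , d₂ , (y , core₂ , i≡₂ , j≡₂ , _ , rejected , steps) , guard₂ =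
      _ , _ , seq storeⁿ (seq assignⁿ (seq exec₁ (seq exec₂ assignⁿ))) , time ,
      y , core₂ , trans (cong (ℕ._+ 1) i≡₂) (trans (ℕ.+-comm _ 1) (cong suc (sym i≡))) , steps ,
      rejected⇒full (core-feasible {g₀} {g} {y} {s₂} core₂)
        (subst (λ d → Rejected g y i (2 ℕ.^ d)) (trans (sym j≡₂) (ℕ.n<1⇒n≡0 (≤ᵇ-false guard₂))) rejected)
      where
      level≤ : natReg s₁ 4 ℕ.≤ suc (lg (lookup Bs i))
      level≤ = ℕ.m+n≤o⇒m≤o _ (ℕ.≤-reflexive j≡₁)
      time : 3 ℕ.+ (2 ℕ.+ (t₁ ℕ.+ (t₂ ℕ.+ 4))) ℕ.≤ itemCost (lg (lookup Bs i))
      time = ℕ.≤-trans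
        (ℕ.+-monoʳ-≤ 5 (ℕ.+-mono-≤ t₁≤ (ℕ.+-monoˡ-≤ 4 (ℕ.≤-trans t₂≤ (ℕ.+-monoˡ-≤ 4 (ℕ.*-monoˡ-≤ 49 level≤))))))
        (item-time (lg (lookup Bs i)))

  weight : ℕ → ℕ
  weight j = suc (lg (toArray Bs j))

  opaque
    unfolding itemCost

    -- The time of the last d items of a pass.
    itemsCost : ℕ → ℕ
    itemsCost d = 106 ℕ.* sumFromⁿ weight (n ℕ.∸ d) d ℕ.+ 6

    itemsCost-total : itemsCost n ≡ 106 ℕ.* sumFromⁿ weight 0 n ℕ.+ 6
    itemsCost-total = cong (λ j → 106 ℕ.* sumFromⁿ weight j n ℕ.+ 6) (ℕ.n∸n≡0 n)

    6≤itemsCost : ∀ d → 6 ℕ.≤ itemsCost d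
    6≤itemsCost d = ℕ.m≤n+m 6 _

    -- The 6 steps of the loop test are charged to the weight `suc l`, which is at least 1; hence
    -- 106 = 100 + 6.
    itemsCost-suc : ∀ l d → sumFromⁿ weight (n ℕ.∸ suc d) (suc d) ≡ suc l ℕ.+ sumFromⁿ weight (n ℕ.∸ d) d →
      6 ℕ.+ (itemCost l ℕ.+ itemsCost d) ℕ.≤ itemsCost (suc d)
    itemsCost-suc l d = bound l (sumFromⁿ weight (n ℕ.∸ d) d)
      where
      open ℕ.≤-Reasoning
      bound : ∀ l S {T} → T ≡ suc l ℕ.+ S → 6 ℕ.+ (100 ℕ.* suc l ℕ.+ (106 ℕ.* S ℕ.+ 6)) ℕ.≤ 106 ℕ.* T ℕ.+ 6
      bound l S refl = begin
        6 ℕ.+ (100 ℕ.* suc l ℕ.+ (106 ℕ.* S ℕ.+ 6))               ≤⟨ ℕ.+-monoˡ-≤ _ (ℕ.*-monoʳ-≤ 6 (ℕ.s≤s (ℕ.z≤n {l}))) ⟩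
        6 ℕ.* suc l ℕ.+ (100 ℕ.* suc l ℕ.+ (106 ℕ.* S ℕ.+ 6))     ≡⟨ ℕ.+-assoc (6 ℕ.* suc l) (100 ℕ.* suc l) _ ⟨
        6 ℕ.* suc l ℕ.+ 100 ℕ.* suc l ℕ.+ (106 ℕ.* S ℕ.+ 6)       ≡⟨ cong (ℕ._+ (106 ℕ.* S ℕ.+ 6)) (ℕ.*-distribʳ-+ (suc l) 6 100) ⟨
        106 ℕ.* suc l ℕ.+ (106 ℕ.* S ℕ.+ 6)                       ≡⟨ ℕ.+-assoc (106 ℕ.* suc l) (106 ℕ.* S) 6 ⟨
        106 ℕ.* suc l ℕ.+ 106 ℕ.* S ℕ.+ 6                         ≡⟨ cong (ℕ._+ 6) (ℕ.*-distribˡ-+ 106 (suc l) S) ⟨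
        106 ℕ.* (suc l ℕ.+ S) ℕ.+ 6                               ∎

  Items : Carrier → Carrier → Vec ℕ n → ℕ → State → Set
  Items g₀ g x₀ d s = ∃[ x ] Core g₀ g x s × natReg s 2 ℕ.+ d ≡ n × Steps g x₀ x × (∀ i → toℕ i ℕ.< natReg s 2 → Full g x i)

  no-more-items : ∀ {s d} → natReg s 0 ≡ n → natReg s 2 ℕ.+ d ≡ n → evalᵇ moreItems s ≡ false → d ≡ 0
  no-more-items {s} {d} n≡ i+d≡n guard = ℕ.n≤0⇒n≡0 (ℕ.+-cancelˡ-≤ (natReg s 2) d 0
    (subst₂ ℕ._≤_ (sym i+d≡n) (sym (ℕ.+-identityʳ _))
      (ℕ.s≤s⁻¹ (subst₂ ℕ._<_ n≡ (ℕ.+-comm _ 1) (≤ᵇ-false guard)))))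

  all-items : ∀ {s} → natReg s 0 ≡ n → natReg s 2 ℕ.+ 0 ≡ n → evalᵇ moreItems s ≡ false
  all-items {s} n≡ i≡n = <⇒≤ᵇ-false (subst₂ ℕ._<_ (sym n≡) (ℕ.+-comm 1 _)
    (ℕ.s≤s (ℕ.≤-reflexive (trans (sym i≡n) (ℕ.+-identityʳ _)))))

  items-step : ∀ {g₀ g x₀ d s} (i : Fin n) → natReg s 2 ≡ toℕ i → Items g₀ g x₀ (suc d) s →
    Runs itemBody s (Items g₀ g x₀ d) (itemCost (lg (lookup Bs i)))
  items-step {g₀} {g} {x₀} {d} {s} i i≡ (x , core , i+1+d≡n , steps , full) = extend (item-step g₀ g i {x} {s} core i≡)
    where
    full-before : ∀ {y m} → Feasible B Bs y → m ≡ suc (natReg s 2) → Steps g x y → Full g y i →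
      ∀ j → toℕ j ℕ.< m → Full g y j
    full-before {y} y∈ refl steps′ full′ j (ℕ.s≤s j≤i) with ℕ.m≤n⇒m<n∨m≡n j≤i
    ... | inj₁ j<i = saturated-mono f mono dr (steps⇒≼ steps′) y∈ j (full j j<i)
    ... | inj₂ j≡i = subst (Full g y) (sym (Fin.toℕ-injective (trans j≡i i≡))) full′
    extend : ∀ {τ} → Runs itemBody s (λ s′ → ∃[ y ] Core g₀ g y s′ × natReg s′ 2 ≡ suc (natReg s 2) × Steps g x y × Full g y i) τ →
      Runs itemBody s (Items g₀ g x₀ d) τ
    extend (s′ , t , exec , t≤ , y , core′ , i′≡ , steps′ , full′) = s′ , t , exec , t≤ ,
      y , core′ , trans (cong (ℕ._+ d) i′≡) (trans (sym (ℕ.+-suc _ d)) i+1+d≡n) , steps ◅◅ steps′ ,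
      full-before (core-feasible {g₀} {g} {y} {s′} core′) i′≡ steps′ full′

  items-time : ∀ {d k} (i : Fin n) → k ≡ toℕ i → k ℕ.+ suc d ≡ n →
    6 ℕ.+ (itemCost (lg (lookup Bs i)) ℕ.+ itemsCost d) ℕ.≤ itemsCost (suc d)
  items-time {d} {k} i i≡ i+1+d≡n = itemsCost-suc (lg (lookup Bs i)) d (cong₂ ℕ._+_
    (trans (cong weight first≡) (cong (suc ∘ lg) (toArray-lookup Bs i)))
    (cong (λ j → sumFromⁿ weight j d) rest≡))
    where
    first≡ : n ℕ.∸ suc d ≡ toℕ i
    first≡ = trans (cong (ℕ._∸ suc d) (sym i+1+d≡n)) (trans (ℕ.m+n∸n≡m k (suc d)) i≡)
    rest≡ : suc (n ℕ.∸ suc d) ≡ n ℕ.∸ d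
    rest≡ = sym (ℕ.+-∸-assoc 1 (subst (suc d ℕ.≤_) i+1+d≡n (ℕ.m≤n+m (suc d) k)))

  items : ∀ g₀ g x₀ d {s} → Items g₀ g x₀ d s → Runs (WHILE moreItems DO itemBody) s
    (λ s′ → ∃[ d′ ] Items g₀ g x₀ d′ s′ × evalᵇ moreItems s′ ≡ false) (itemsCost d)
  items g₀ g x₀ = while-rule (Items g₀ g x₀) itemsCost 6≤itemsCost
    (λ {s} (_ , (n≡ , _) , i≡n , _) → all-items {s} n≡ i≡n) step
    where
    step : ∀ {d s} → Items g₀ g x₀ (suc d) s → evalᵇ moreItems s ≡ true →
      ∃[ τ ] 6 ℕ.+ (τ ℕ.+ itemsCost d) ℕ.≤ itemsCost (suc d) × Runs itemBody s (Items g₀ g x₀ d) τ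
    step {d} {s} inv@(_ , _ , i+1+d≡n , _) _ = itemCost (lg (lookup Bs i)) , items-time i i≡ i+1+d≡n , items-step i i≡ inv
      where
      i<n : natReg s 2 ℕ.< n
      i<n = subst (natReg s 2 ℕ.<_) i+1+d≡n (ℕ.m<m+n _ (ℕ.s≤s ℕ.z≤n))
      i = fromℕ< i<n
      i≡ : natReg s 2 ≡ toℕ i
      i≡ = sym (Fin.toℕ-fromℕ< i<n)

  pass : ∀ {g₀ g x s} → Core g₀ g x s → Good g x → Runs passBody s
    (λ s′ → ∃[ y ] Core g₀ (g ÷ (1# + δ)) y s′ × Good (g ÷ (1# + δ)) y) (9 ℕ.+ itemsCost n)
  pass {g₀} {g} {x} {s} (n≡ , B≡ , Bs≡ , δ≡ , g₀≡ , g≡ , x∈) good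
    with items g₀ (g ÷ (1# + δ)) x n {setNatReg 2 0 (setRealReg 1 (realReg s 1 ÷ (fromℕ 1 + realReg s 0)) s)}
      (x , (n≡ , B≡ , Bs≡ , δ≡ , g₀≡ , cong₂ _÷_ g≡ (cong₂ _+_ fromℕ-1 δ≡) , x∈) , refl , Star.ε , λ _ ())
  ... | s′ , t , exec , t≤ , d , (y , core′ , i+d≡n , steps , full) , guard =
    s′ , _ , seq assignʳ (seq assignⁿ exec) , ℕ.+-monoʳ-≤ 9 t≤ , y , core′ ,
    good-pass good steps λ i → full i (subst (toℕ i ℕ.<_) (sym i≡n) (Fin.toℕ<n i))
    where
    i≡n : natReg s′ 2 ≡ n
    i≡n = trans (sym (ℕ.+-identityʳ _)) (trans (cong (natReg s′ 2 ℕ.+_) (sym (no-more-items {s′} (proj₁ core′) i+d≡n guard))) i+d≡n)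

  passesCost : ℕ → ℕ
  passesCost d = d ℕ.* (19 ℕ.+ itemsCost n) ℕ.+ 10

  -- Each pass divides `g` by 1 + δ and so lowers the exponent by one; at exponent 0 the inequality
  -- is the exit condition itself.
  Passes : Carrier → ℕ → State → Set
  Passes g₀ d s = ∃[ g ] ∃[ x ] Core g₀ g x s × Good g x × fromℕ n * g ≤ δ * g₀ * (1# + δ) ^ d

  passes : ∀ g₀ d {s} → Passes g₀ d s → Runs (WHILE passGuard DO passBody) s
    (λ s′ → ∃[ d′ ] Passes g₀ d′ s′ × evalᵇ passGuard s′ ≡ false) (passesCost d)
  passes g₀ = while-rule (Passes g₀) passesCost (λ d → ℕ.m≤n+m 10 _)
    (λ {s} → stop {s}) (λ {d} {s} → step {d} {s})
    where
    stop : ∀ {s} → Passes g₀ 0 s → evalᵇ passGuard s ≡ false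
    stop {s} (g , x , (n≡ , B≡ , Bs≡ , δ≡ , g₀≡ , g≡ , _) , _ , small)
      with fromℕ (natReg s 0) * realReg s 1 ≤? realReg s 0 * realReg s 2
    ... | yes _   = refl
    ... | no  ng≰ = contradiction (subst₂ _≤_ (cong₂ (λ n g → fromℕ n * g) (sym n≡) (sym g≡))
            (trans (*-identityʳ _) (cong₂ _*_ (sym δ≡) (sym g₀≡))) small) ng≰
    shrink : ∀ g d → fromℕ n * g ≤ δ * g₀ * (1# + δ) ^ suc d → fromℕ n * (g ÷ (1# + δ)) ≤ δ * g₀ * (1# + δ) ^ d
    shrink g d small = *-cancelʳ-≤ 0<1+δ (subst₂ _≤_
      (trans (cong (fromℕ n *_) (sym (x÷y*y≡x g 0<1+δ))) (sym (*-assoc _ _ _)))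
      (solve 3 (λ a b c → a :* (b :* c) := a :* c :* b) refl (δ * g₀) (1# + δ) ((1# + δ) ^ d)) small)
    step : ∀ {d s} → Passes g₀ (suc d) s → evalᵇ passGuard s ≡ true →
      ∃[ τ ] suc (costᵇ passGuard ℕ.+ (τ ℕ.+ passesCost d)) ℕ.≤ passesCost (suc d) × Runs passBody s (Passes g₀ d) τ
    step {d} {s} (g , x , core , good , small) _ with pass {g₀} {g} {x} {s} core good
    ... | s′ , t , exec , t≤ , y , core′ , good′ = 9 ℕ.+ itemsCost n ,
      ℕ.≤-reflexive (cong (19 ℕ.+_) (sym (ℕ.+-assoc (itemsCost n) _ 10))) ,
      s′ , t , exec , t≤ , g ÷ (1# + δ) , y , core′ , good′ , shrink g d small

  𝟎 : Vec ℕ n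
  𝟎 = replicate n 0

  -- min (Bᵢ, B) as the program computes it.
  cap : ℕ → ℕ
  cap j = toArray Bs j ℕ.∸ (toArray Bs j ℕ.∸ B)

  ≤cap : ∀ i k → k ℕ.≤ lookup Bs i → k ℕ.≤ B → k ℕ.≤ cap (toℕ i)
  ≤cap i k k≤Bᵢ k≤B rewrite toArray-lookup Bs i with ℕ.≤-total B (lookup Bs i)
  ... | inj₁ B≤Bᵢ = subst (k ℕ.≤_) (sym (ℕ.m∸[m∸n]≡n B≤Bᵢ)) k≤B
  ... | inj₂ Bᵢ≤B = subst (λ h → k ℕ.≤ lookup Bs i ℕ.∸ h) (sym (ℕ.m≤n⇒m∸n≡0 Bᵢ≤B)) k≤Bᵢ

  cap-feasible : ∀ i → Feasible B Bs (spike i (cap (toℕ i)))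
  cap-feasible i rewrite toArray-lookup Bs i =
    subst (_≼ Bs) (Vec.zipWith-identityˡ ℕ.+-identityˡ _) (⊕-spike-≼ i c (replicate-0≼ Bs)
      (subst (λ h → h ℕ.+ c ℕ.≤ Bᵢ) (sym (Vec.lookup-replicate i 0)) (ℕ.m∸n≤m Bᵢ (Bᵢ ℕ.∸ B)))) ,
    subst (ℕ._≤ B) (sym (sum-spike i c)) (ℕ.m≤n+o⇒m∸n≤o Bᵢ (Bᵢ ℕ.∸ B)
      (subst (Bᵢ ℕ.≤_) (ℕ.+-comm B _) (ℕ.m≤n+m∸n Bᵢ B)))
    where
    Bᵢ = lookup Bs i
    c = Bᵢ ℕ.∸ (Bᵢ ℕ.∸ B)

  open RangeSum _+_ 0# using (sumFrom; sumFrom-tabulate)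

  increment : ℕ → Carrier
  increment j = f (cells n (update (λ _ → 0) j (cap j))) - f 𝟎

  g₀ : Carrier
  g₀ = sumFrom increment 0 n

  increment-spike : ∀ i → increment (toℕ i) ≡ f (spike i (cap (toℕ i))) - f 𝟎
  increment-spike i = cong (λ v → f v - f 𝟎) (trans (cells-update i (λ _ → 0) (cap (toℕ i)))
    (trans (cong (_⊕ spike i (cap (toℕ i))) (cells-0 λ _ → refl)) (Vec.zipWith-identityˡ ℕ.+-identityˡ _)))

  g₀-sum : g₀ ≡ sum (tabulate λ i → f (spike i (cap (toℕ i))) - f 𝟎)
  g₀-sum = trans (sumFrom-tabulate n increment) (cong sum (Vec.tabulate-cong increment-spike))

  gap≤g₀ : gap 𝟎 ≤ g₀
  gap≤g₀ = subst (gap 𝟎 ≤_) (sym g₀-sum) (initial-gap f mono dr (cap ∘ toℕ) ≤cap _ (proj₁ (proj₂ (proj₁ isMaximum))))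

  0≤g₀ : 0# ≤ g₀
  0≤g₀ = Good.nonNeg (good-initial gap≤g₀)

  g₀≤n*OPT : g₀ ≤ fromℕ n * OPT
  g₀≤n*OPT = subst (_≤ fromℕ n * OPT) (sym g₀-sum) (sum-≤ (tabulate h) OPT λ i →
    subst (_≤ OPT) (sym (Vec.lookup∘tabulate h i)) (≤-by
      (+-nonNeg (f≥0 𝟎) (x≤y⇒0≤y-x (proj₂ isMaximum _ (cap-feasible i))))
      (solve 3 (λ O p q → O :- (p :- q) := q :+ (O :- p)) refl OPT (f (spike i (cap (toℕ i)))) (f 𝟎))))
    where
    h : Fin n → Carrier
    h i = f (spike i (cap (toℕ i))) - f 𝟎

  Estimate : ℕ → State → Set
  Estimate d s = natReg s 0 ≡ n × natReg s 1 ≡ B × natArr s 1 ≡ toArray Bs × realReg s 0 ≡ δ ×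
    (∀ j → natArr s 0 j ≡ 0) × natReg s 3 ≡ 0 × realReg s 3 ≡ f 𝟎 ×
    natReg s 2 ℕ.+ d ≡ n × realReg s 2 + sumFrom increment (natReg s 2) d ≡ g₀

  estimateCost : ℕ → ℕ
  estimateCost d = d ℕ.* 29 ℕ.+ 6

  estimate-step : ∀ {d s} → Estimate (suc d) s → Runs estimateBody s (Estimate d) 23
  estimate-step {d} {s} (n≡ , B≡ , Bs≡ , δ≡ , zeros , used≡ , value≡ , i≡ , acc≡) =
    _ , _ , seq storeⁿ (seq query (seq storeⁿ (seq assignʳ assignⁿ))) , ℕ.≤-refl ,
    n≡ , B≡ , Bs≡ , δ≡ , zeros′ , used≡ , value≡ , trans (ℕ.+-assoc k 1 d) i≡ , acc′
    where
    open ≤-Reasoning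
    k = natReg s 2
    v = natArr s 1 k ℕ.∸ (natArr s 1 k ℕ.∸ natReg s 1)
    zeros′ : ∀ j → update (update (natArr s 0) k v) k 0 j ≡ 0
    zeros′ j with j ℕ.≟ k
    ... | yes refl = update-updates (update (natArr s 0) k v) k 0
    ... | no  j≢k  = trans (update-minimal (update (natArr s 0) k v) 0 j≢k) (trans (update-minimal (natArr s 0) v j≢k) (zeros j))
    v≡ : v ≡ cap k
    v≡ = cong₂ (λ a B → a k ℕ.∸ (a k ℕ.∸ B)) Bs≡ B≡
    probe : ∀ j → update (natArr s 0) k v j ≡ update (λ _ → 0) k (cap k) j
    probe j with j ≡ᵇ k
    ... | true  = v≡
    ... | false = zeros j
    acc′ : realReg s 2 + (f (cells n (update (natArr s 0) k v)) - realReg s 3) + sumFrom increment (k ℕ.+ 1) d ≡ g₀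
    acc′ = begin-equality
      realReg s 2 + (f (cells n (update (natArr s 0) k v)) - realReg s 3) + sumFrom increment (k ℕ.+ 1) d
        ≡⟨ cong₂ (λ h j → realReg s 2 + h + sumFrom increment j d)
             (cong₂ _-_ (cong f (Vec.tabulate-cong (probe ∘ toℕ))) value≡) (ℕ.+-comm k 1) ⟩
      realReg s 2 + increment k + sumFrom increment (suc k) d
        ≡⟨ +-assoc _ _ _ ⟩
      realReg s 2 + sumFrom increment k (suc d)
        ≡⟨ acc≡ ⟩
      g₀ ∎

  estimate : ∀ d {s} → Estimate d s → Runs (WHILE moreItems DO estimateBody) s
    (λ s′ → ∃[ d′ ] Estimate d′ s′ × evalᵇ moreItems s′ ≡ false) (estimateCost d)
  estimate = while-rule Estimate estimateCost (λ d → ℕ.m≤n+m 6 _)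
    (λ { {s} (n≡ , _ , _ , _ , _ , _ , _ , i≡ , _) → all-items {s} n≡ i≡ })
    (λ inv _ → 23 , ℕ.≤-refl , estimate-step inv)

  greedyCost : ℕ → ℕ
  greedyCost d = 1 ℕ.+ (estimateCost n ℕ.+ (2 ℕ.+ passesCost d))

  approximates : ∀ {g x} → Good g x → fromℕ n * g ≤ δ * g₀ → Approximates ℝ δ B Bs f x
  approximates {g} {x} good small with Good.bounded good
  ... | inj₁ full  = full⇒approximates good full
  ... | inj₂ gap≤g = gap⇒approximates good (small-gap n refl)
    where
    small-gap : ∀ m → m ≡ n → gap x ≤ δ * OPT
    -- Without items the exit condition says nothing about g, but then there is only one vector.
    small-gap zero refl = ≤-by (*-nonNeg (proj₁ 0<δ) 0≤OPT) (trans (cong (λ h → δ * OPT - (OPT - f h)) (unique x _))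
      (solve 2 (λ O d → d :* O :- (O :- O) := d :* O) refl OPT δ))
      where
      unique : ∀ (x y : Vec ℕ 0) → x ≡ y
      unique [] [] = refl
    small-gap (suc m) refl = ≤-trans gap≤g (*-cancelʳ-≤ (0<fromℕ-suc m) (begin
      g * fromℕ n           ≡⟨ *-comm g (fromℕ n) ⟩
      fromℕ n * g           ≤⟨ small ⟩
      δ * g₀                ≤⟨ *-monoʳ-≤ (proj₁ 0<δ) g₀≤n*OPT ⟩
      δ * (fromℕ n * OPT)   ≡⟨ solve 3 (λ d n O → d :* (n :* O) := d :* O :* n) refl δ (fromℕ n) OPT ⟩
      δ * OPT * fromℕ n     ∎))
      where open ≤-Reasoning

  greedy-runs : ∀ d → fromℕ n ≤ δ * (1# + δ) ^ d →
    Runs greedy (initial δ B Bs) (λ s → Approximates ℝ δ B Bs f (output n s)) (greedyCost d)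
  greedy-runs d n≤
    with estimate n {setRealReg 3 (f (readVec n 0 (initial δ B Bs))) (initial δ B Bs)}
      (refl , refl , refl , refl , (λ _ → refl) , refl , cong f (cells-0 λ _ → refl) , refl , +-identityˡ g₀)
  ... | s₁ , t₁ , exec₁ , t₁≤ , d₁ , (n≡ , B≡ , Bs≡ , δ≡ , zeros , used≡ , value≡ , i≡ , acc≡) , guard₁
    with passes g₀ d {setRealReg 1 (realReg s₁ 2) s₁}
      (g₀ , 𝟎 , (n≡ , B≡ , Bs≡ , δ≡ , acc , acc , cells-0 zeros , trans used≡ (sym (sum-replicate-0 n)) , value≡ ,
        Good.feasible (good-initial gap≤g₀)) , good-initial gap≤g₀ , start)
    where
    acc : realReg s₁ 2 ≡ g₀
    acc = trans (sym (+-identityʳ _)) (trans (cong (λ d → realReg s₁ 2 + sumFrom increment (natReg s₁ 2) d)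
      (sym (no-more-items {s₁} n≡ i≡ guard₁))) acc≡)
    start : fromℕ n * g₀ ≤ δ * g₀ * (1# + δ) ^ d
    start = subst (fromℕ n * g₀ ≤_) (solve 3 (λ a b c → a :* b :* c := a :* c :* b) refl δ ((1# + δ) ^ d) g₀)
      (*-monoˡ-≤ 0≤g₀ n≤)
  ... | s₂ , t₂ , exec₂ , t₂≤ , _ , (g , x , core₂@(n≡₂ , B≡₂ , Bs≡₂ , δ≡₂ , g₀≡₂ , g≡₂ , x≡₂ , _) , good , _) , guard₂ =
    s₂ , _ , seq query (seq exec₁ (seq assignʳ exec₂)) , ℕ.s≤s (ℕ.+-mono-≤ t₁≤ (ℕ.+-monoʳ-≤ 2 t₂≤)) ,
    subst (Approximates ℝ δ B Bs f) (sym x≡₂) (approximates good (small guard₂))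
    where
    small : evalᵇ passGuard s₂ ≡ false → fromℕ n * g ≤ δ * g₀
    small guard with fromℕ (natReg s₂ 0) * realReg s₂ 1 ≤? realReg s₂ 0 * realReg s₂ 2
    ... | yes le = subst₂ _≤_ (cong₂ (λ n g → fromℕ n * g) n≡₂ g≡₂) (cong₂ _*_ δ≡₂ g₀≡₂) le
    small () | no _

-- Descending from a success until the first failure gives an index where the predicate switches,
-- and thus the two-sided estimates of `rounds` and `phases`.
first-success : ∀ {P : ℕ → Set} → Decidable P → ∀ k → P k → P 0 ⊎ ∃[ j ] (¬ P j × P (suc j))
first-success P? zero    p = inj₁ p
first-success P? (suc k) p with P? k
... | yes pk = first-success P? k pk
... | no ¬pk = inj₂ (k , ¬pk , p)

-- The number of passes and the time bound

module TimeBound (ℝ : RealNumbers) where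
  open Submodular ℝ
  open Semantics ℝ
  open ≤-Reasoning

  weights : ∀ {n} → Vec ℕ n → ℕ
  weights {n} Bs = sumFromⁿ (λ j → suc (lg (toArray Bs j))) 0 n

  n≤weights : ∀ {n} (Bs : Vec ℕ n) → n ℕ.≤ weights Bs
  n≤weights []            = ℕ.z≤n
  n≤weights {suc n} (b ∷ Bs) = ℕ.s≤s (ℕ.≤-trans (subst (n ℕ.≤_) (sym (sumFromⁿ-suc _ 0 n)) (n≤weights Bs)) (ℕ.m≤n+m _ (lg b)))

  lg≤log₂ : ∀ k → 0 ℕ.< k → fromℕ (lg k) ≤ log₂ (fromℕ k)
  lg≤log₂ (suc k) _ = 2^k≤x⇒k≤log₂ (lg (suc k)) (subst (_≤ fromℕ (suc k)) (fromℕ-2^ (lg (suc k))) (fromℕ-mono (proj₁ (lg-bounds k))))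

  logs : ∀ {n} → Vec ℕ n → Carrier
  logs Bs = sum (Vec.map (λ b → log₂ (fromℕ b)) Bs)

  0≤logs : ∀ {n} (Bs : Vec ℕ n) → (∀ i → 0 ℕ.< lookup Bs i) → 0# ≤ logs Bs
  0≤logs []       Bs>0 = ≤-refl
  0≤logs (b ∷ Bs) Bs>0 = +-nonNeg (≤-trans (fromℕ-nonNeg (lg b)) (lg≤log₂ b (Bs>0 zero))) (0≤logs Bs (Bs>0 ∘ suc))

  weights≤n+logs : ∀ {n} (Bs : Vec ℕ n) → (∀ i → 0 ℕ.< lookup Bs i) → fromℕ (weights Bs) ≤ fromℕ n + logs Bs
  weights≤n+logs []       Bs>0 = ≤-reflexive (sym (+-identityʳ 0#))
  weights≤n+logs {suc n} (b ∷ Bs) Bs>0 = begin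
    1# + fromℕ (lg b ℕ.+ sumFromⁿ (λ j → suc (lg (toArray (b ∷ Bs) j))) 1 n)
      ≡⟨ cong (λ h → 1# + fromℕ (lg b ℕ.+ h)) (sumFromⁿ-suc _ 0 n) ⟩
    1# + fromℕ (lg b ℕ.+ weights Bs)
      ≡⟨ cong (1# +_) (fromℕ-+ (lg b) (weights Bs)) ⟩
    1# + (fromℕ (lg b) + fromℕ (weights Bs))
      ≤⟨ +-mono-≤ ≤-refl (+-mono-≤ (lg≤log₂ b (Bs>0 zero)) (weights≤n+logs Bs (Bs>0 ∘ suc))) ⟩
    1# + (log₂ (fromℕ b) + (fromℕ n + logs Bs))
      ≡⟨ solve 3 (λ l n s → 1: :+ (l :+ (n :+ s)) := 1: :+ n :+ (l :+ s)) refl (log₂ (fromℕ b)) (fromℕ n) (logs Bs) ⟩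
    1# + fromℕ n + (log₂ (fromℕ b) + logs Bs) ∎

  -- Chosen for the case of small X in `threshold-arithmetic`: at X = 2 and j = 1 the left side is
  -- 11, and no positive lower bound on the logarithm is available.
  12# : Carrier
  12# = (1# + 2#) * (2# * 2#)

  -- If X < 2 then everything is bounded by a constant, and otherwise log₂ X ≥ 1.
  threshold-arithmetic : ∀ {X l j} → 0# ≤ X → 0# ≤ j → j ≤ l → 1# ≤ l ⊎ X ≤ 2# × j ≤ 1# →
    1# + (X + 2# * (1# + j) * X) ≤ 12# * (1# + X * l)
  threshold-arithmetic {X} {l} {j} 0≤X 0≤j j≤l (inj₁ 1≤l) = ≤-by
    (+-nonNeg (+-nonNeg (*-nonNeg (*-nonNeg (+-nonNeg 0≤1 0≤2) 0≤X) (x≤y⇒0≤y-x 1≤l))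
                        (*-nonNeg (*-nonNeg 0≤2 0≤X) (x≤y⇒0≤y-x j≤l)))
      (+-nonNeg (*-nonNeg (*-nonNeg (+-nonNeg 0≤1 (*-nonNeg 0≤2 (+-nonNeg 0≤1 0≤2))) 0≤X) (≤-trans 0≤j j≤l))
        (+-nonNeg 0≤1 (*-nonNeg 0≤2 (+-nonNeg 0≤1 (*-nonNeg 0≤2 0≤2))))))
    (solve 3 (λ X l j → (1: :+ 2:) :* (2: :* 2:) :* (1: :+ X :* l) :- (1: :+ (X :+ 2: :* (1: :+ j) :* X)) :=
        ((1: :+ 2:) :* X :* (l :- 1:) :+ 2: :* X :* (l :- j)) :+
        ((1: :+ 2: :* (1: :+ 2:)) :* X :* l :+ (1: :+ 2: :* (1: :+ 2: :* 2:)))) refl X l j)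
  threshold-arithmetic {X} {l} {j} 0≤X 0≤j j≤l (inj₂ (X≤2 , j≤1)) = ≤-by
    (+-nonNeg (*-nonNeg (*-nonNeg (+-nonNeg 0≤1 0≤2) (*-nonNeg 0≤2 0≤2)) (*-nonNeg 0≤X (≤-trans 0≤j j≤l)))
      (+-nonNeg (*-nonNeg (*-nonNeg 0≤2 0≤X) (x≤y⇒0≤y-x j≤1))
        (+-nonNeg (*-nonNeg (+-nonNeg 0≤1 (*-nonNeg 0≤2 0≤2)) (x≤y⇒0≤y-x X≤2)) 0≤1)))
    (solve 3 (λ X l j → (1: :+ 2:) :* (2: :* 2:) :* (1: :+ X :* l) :- (1: :+ (X :+ 2: :* (1: :+ j) :* X)) :=
        (1: :+ 2:) :* (2: :* 2:) :* (X :* l) :+ (2: :* X :* (1: :- j) :+ ((1: :+ 2: :* 2:) :* (2: :- X) :+ 1:)))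
      refl X l j)

  module _ {δ : Carrier} (0<δ : 0# < δ) (δ<1 : δ < 1#) where

    x≤x÷δ : ∀ {x} → 0# ≤ x → x ≤ x ÷ δ
    x≤x÷δ {x} 0≤x = x*z≤y⇒x≤y÷z 0<δ (≤-by (*-nonNeg 0≤x (x≤y⇒0≤y-x (proj₁ δ<1)))
      (solve 2 (λ x d → x :- x :* d := x :* (1: :- d)) refl x δ))

    -- 1/δ rounded up: by Bernoulli q divisions by 1 + δ at least halve g, and q δ ≤ 2 keeps q of
    -- order 1/δ.
    rounds : ∃[ q ] 1# ≤ fromℕ q * δ × fromℕ q * δ ≤ 2#
    rounds with archimedean (1# ÷ δ)
    ... | k , 1/δ≤k with first-success (λ q → 1# ≤? fromℕ q * δ) k (subst (_≤ fromℕ k * δ) (x÷y*y≡x 1# 0<δ) (*-monoˡ-≤ (proj₁ 0<δ) 1/δ≤k))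
    ... | inj₁ 1≤0 = 0 , 1≤0 , ≤-by 0≤2 (solve 1 (λ d → 2: :- 0: :* d := 2:) refl δ)
    ... | inj₂ (q , ≰ , 1≤) = suc q , 1≤ , ≤-by (+-nonNeg (x≤y⇒0≤y-x (≰⇒≥ ≰)) (x≤y⇒0≤y-x (proj₁ δ<1)))
      (solve 2 (λ q d → 2: :- (1: :+ q) :* d := (1: :- q :* d) :+ (1: :- d)) refl (fromℕ q) δ)

    -- The least exponent is a successor since δ < 1 ≤ n.
    phases : ∀ n → ∃[ j ] fromℕ (suc n) ≤ δ * 2# ^ suc j × δ * 2# ^ j ≤ fromℕ (suc n)
    phases n with ≤2^ (fromℕ (suc n) ÷ δ)
    ... | k , le with first-success (λ j → fromℕ (suc n) ≤? δ * 2# ^ j) k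
        (subst₂ _≤_ (x÷y*y≡x _ 0<δ) (*-comm _ δ) (*-monoˡ-≤ (proj₁ 0<δ) le))
    ... | inj₂ (j , ≰ , le′) = j , le′ , ≰⇒≥ ≰
    ... | inj₁ n≤δ = contradiction (antisym (proj₁ δ<1)
            (≤-trans (1≤fromℕ-suc n) (subst (fromℕ (suc n) ≤_) (*-identityʳ δ) n≤δ))) (proj₂ δ<1)

    module _ (n : ℕ) (Bs : Vec ℕ (suc n)) (Bs>0 : ∀ i → 0 ℕ.< lookup Bs i) where

      private
        q = proj₁ rounds
        j = proj₁ (phases n)
        N = fromℕ (suc n)
        m = size ℝ δ Bs
        X = m ÷ δ

      -- `suc j` halvings of g at `q` passes each.
      thresholds : ℕ
      thresholds = q ℕ.* suc j

      thresholds-suffice : N ≤ δ * (1# + δ) ^ thresholds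
      thresholds-suffice = begin
        N                                ≤⟨ proj₁ (proj₂ (phases n)) ⟩
        δ * 2# ^ suc j                   ≤⟨ *-monoʳ-≤ (proj₁ 0<δ) (^-monoˡ-≤ (suc j) 0≤2 (begin
          1# + 1#                            ≤⟨ +-mono-≤ ≤-refl (proj₁ (proj₂ rounds)) ⟩
          1# + fromℕ q * δ                   ≤⟨ bernoulli q δ (+-nonNeg 0≤1 (proj₁ 0<δ)) ⟩
          (1# + δ) ^ q                       ∎)) ⟩
        δ * ((1# + δ) ^ q) ^ suc j       ≡⟨ cong (δ *_) (^-assocʳ (1# + δ) q (suc j)) ⟩
        δ * (1# + δ) ^ thresholds        ∎

      private
        N≤m : N ÷ δ ≤ m
        N≤m = ≤-by (0≤logs Bs Bs>0) (solve 2 (λ a b → a :+ b :- a := b) refl (N ÷ δ) (logs Bs))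

        W≤m : fromℕ (weights Bs) ≤ m
        W≤m = ≤-trans (weights≤n+logs Bs Bs>0) (+-mono-≤ (x≤x÷δ (fromℕ-nonNeg (suc n))) ≤-refl)

        0≤m : 0# ≤ m
        0≤m = ≤-trans (fromℕ-nonNeg (weights Bs)) W≤m

        m≤X : m ≤ X
        m≤X = x≤x÷δ 0≤m

        0≤X : 0# ≤ X
        0≤X = ≤-trans 0≤m m≤X

        2^j≤X : 2# ^ j ≤ X
        2^j≤X = ≤-trans (x*z≤y⇒x≤y÷z 0<δ (subst (_≤ N) (*-comm δ _) (proj₂ (proj₂ (phases n))))) (≤-trans N≤m m≤X)

        work : fromℕ (thresholds ℕ.* weights Bs) ≤ 2# * (1# + fromℕ j) * X
        work = begin
          fromℕ (q ℕ.* suc j ℕ.* weights Bs)             ≡⟨ fromℕ-* (q ℕ.* suc j) (weights Bs) ⟩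
          fromℕ (q ℕ.* suc j) * fromℕ (weights Bs)       ≤⟨ *-monoʳ-≤ (fromℕ-nonNeg (q ℕ.* suc j)) W≤m ⟩
          -- Writing m as X δ supplies the factor that cancels q up to the constant 2.
          fromℕ (q ℕ.* suc j) * m                        ≡⟨ cong₂ _*_ (fromℕ-* q (suc j)) (sym (x÷y*y≡x m 0<δ)) ⟩
          fromℕ q * (1# + fromℕ j) * (X * δ)
            ≡⟨ solve 4 (λ q J X d → q :* J :* (X :* d) := q :* d :* (J :* X)) refl (fromℕ q) (1# + fromℕ j) X δ ⟩
          fromℕ q * δ * ((1# + fromℕ j) * X)             ≤⟨ *-monoˡ-≤ (*-nonNeg (fromℕ-nonNeg (suc j)) 0≤X) (proj₂ (proj₂ rounds)) ⟩
          2# * ((1# + fromℕ j) * X)                      ≡⟨ *-assoc 2# _ X ⟨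
          2# * (1# + fromℕ j) * X                        ∎

        log-bound : 1# + (X + 2# * (1# + fromℕ j) * X) ≤ 12# * (1# + X * log₂ X)
        log-bound = threshold-arithmetic 0≤X (fromℕ-nonNeg j) (2^k≤x⇒k≤log₂ j 2^j≤X) cases
          where
          cases : 1# ≤ log₂ X ⊎ X ≤ 2# × fromℕ j ≤ 1#
          cases = Sum.map
            (λ 2≤X → subst (_≤ log₂ X) fromℕ-1 (2^k≤x⇒k≤log₂ 1 (subst (_≤ X) (sym (*-identityʳ 2#)) 2≤X)))
            (λ X≤2 → X≤2 , subst (fromℕ j ≤_) fromℕ-1 (fromℕ-mono {j} {1}
              (2^-cancel-≤ (≤-trans 2^j≤X (subst (X ≤_) (sym (*-identityʳ 2#)) X≤2)))))
            (total 2# X)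

      time≤ : fromℕ (1 ℕ.+ (weights Bs ℕ.+ thresholds ℕ.* weights Bs)) ≤ 12# * (1# + timeBound ℝ m δ)
      time≤ = begin
        1# + fromℕ (weights Bs ℕ.+ thresholds ℕ.* weights Bs)           ≡⟨ cong (1# +_) (fromℕ-+ (weights Bs) _) ⟩
        1# + (fromℕ (weights Bs) + fromℕ (thresholds ℕ.* weights Bs))   ≤⟨ +-mono-≤ ≤-refl (+-mono-≤ (≤-trans W≤m m≤X) work) ⟩
        1# + (X + 2# * (1# + fromℕ j) * X)                              ≤⟨ log-bound ⟩
        12# * (1# + X * log₂ X)
          ≡⟨ cong (λ h → 12# * (1# + h)) (solve 3 (λ m i l → m :* i :* l := m :* l :* i) refl m (δ ⁻¹) (log₂ X)) ⟩
        12# * (1# + timeBound ℝ m δ)                                    ∎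

-- The fixed 25 = 19 + 6 steps of a pass are charged to W, which requires W ≥ 1 as soon as passes
-- are counted; hence 131 = 25 + 106. The constant 150 dominates 131, 29 and 19.
greedy-time : ∀ n W d {I} → n ℕ.≤ W → 1 ℕ.≤ W ⊎ d ≡ 0 → I ≡ 106 ℕ.* W ℕ.+ 6 →
  1 ℕ.+ (n ℕ.* 29 ℕ.+ 6 ℕ.+ (2 ℕ.+ (d ℕ.* (19 ℕ.+ I) ℕ.+ 10))) ℕ.≤ 150 ℕ.* (1 ℕ.+ (W ℕ.+ d ℕ.* W))
greedy-time n W d n≤W cases refl = begin
  1 ℕ.+ (n ℕ.* 29 ℕ.+ 6 ℕ.+ (2 ℕ.+ (d ℕ.* (19 ℕ.+ (106 ℕ.* W ℕ.+ 6)) ℕ.+ 10)))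
    ≤⟨ ℕ.+-monoʳ-≤ 1 (ℕ.+-mono-≤ (ℕ.+-monoˡ-≤ 6 (ℕ.*-monoˡ-≤ 29 n≤W)) (ℕ.+-monoʳ-≤ 2 (ℕ.+-monoˡ-≤ 10 (loop cases)))) ⟩
  1 ℕ.+ (W ℕ.* 29 ℕ.+ 6 ℕ.+ (2 ℕ.+ (131 ℕ.* (d ℕ.* W) ℕ.+ 10)))
    ≡⟨ collect W (131 ℕ.* (d ℕ.* W)) ⟩
  19 ℕ.+ (29 ℕ.* W ℕ.+ 131 ℕ.* (d ℕ.* W))
    ≤⟨ ℕ.+-mono-≤ (ℕ.≤ᵇ⇒≤ 19 150 _) (ℕ.+-mono-≤ (ℕ.*-monoˡ-≤ W (ℕ.≤ᵇ⇒≤ 29 150 _)) (ℕ.*-monoˡ-≤ (d ℕ.* W) (ℕ.≤ᵇ⇒≤ 131 150 _))) ⟩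
  150 ℕ.+ (150 ℕ.* W ℕ.+ 150 ℕ.* (d ℕ.* W))
    ≡⟨ cong (150 ℕ.+_) (ℕ.*-distribˡ-+ 150 W (d ℕ.* W)) ⟨
  150 ℕ.+ 150 ℕ.* (W ℕ.+ d ℕ.* W)
    ≡⟨ ℕ.*-distribˡ-+ 150 1 (W ℕ.+ d ℕ.* W) ⟨
  150 ℕ.* (1 ℕ.+ (W ℕ.+ d ℕ.* W)) ∎
  where
  open ℕ.≤-Reasoning
  collect : ∀ W D → 1 ℕ.+ (W ℕ.* 29 ℕ.+ 6 ℕ.+ (2 ℕ.+ (D ℕ.+ 10))) ≡ 19 ℕ.+ (29 ℕ.* W ℕ.+ D)
  collect = solveⁿ 2 (λ W D → conⁿ 1 :+ⁿ (W :*ⁿ conⁿ 29 :+ⁿ conⁿ 6 :+ⁿ (conⁿ 2 :+ⁿ (D :+ⁿ conⁿ 10))) :=ⁿ conⁿ 19 :+ⁿ (conⁿ 29 :*ⁿ W :+ⁿ D)) refl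
  loop : 1 ℕ.≤ W ⊎ d ≡ 0 → d ℕ.* (19 ℕ.+ (106 ℕ.* W ℕ.+ 6)) ℕ.≤ 131 ℕ.* (d ℕ.* W)
  loop (inj₂ refl) = ℕ.z≤n
  loop (inj₁ 1≤W) = begin
    d ℕ.* (19 ℕ.+ (106 ℕ.* W ℕ.+ 6))    ≡⟨ cong (d ℕ.*_) (trans (cong (19 ℕ.+_) (ℕ.+-comm _ 6)) refl) ⟩
    d ℕ.* (25 ℕ.+ 106 ℕ.* W)            ≤⟨ ℕ.*-monoʳ-≤ d (ℕ.+-monoˡ-≤ (106 ℕ.* W) (ℕ.*-monoʳ-≤ 25 1≤W)) ⟩
    d ℕ.* (25 ℕ.* W ℕ.+ 106 ℕ.* W)      ≡⟨ cong (d ℕ.*_) (ℕ.*-distribʳ-+ W 25 106) ⟨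
    d ℕ.* (131 ℕ.* W)                   ≡⟨ ℕ.*-assoc d 131 W ⟨
    d ℕ.* 131 ℕ.* W                     ≡⟨ cong (ℕ._* W) (ℕ.*-comm d 131) ⟩
    131 ℕ.* d ℕ.* W                     ≡⟨ ℕ.*-assoc 131 d W ⟩
    131 ℕ.* (d ℕ.* W)                   ∎

-- Combining correctness with the time bound

module _ (ℝ : RealNumbers) where
  open Submodular ℝ
  open Semantics ℝ
  open TimeBound ℝ

  timeConstant : Carrier
  timeConstant = fromℕ 150 * 12#

  Outcome : ∀ {n} → Carrier → ℕ → Vec ℕ n → (Vec ℕ n → Carrier) → Set
  Outcome {n} ε B Bs f = ∃[ s ] ∃[ t ] Exec f greedy (initial ε B Bs) s t ×
    Approximates ℝ ε B Bs f (output n s) × RunsInTime ℝ timeConstant ε Bs t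

  scale-time : ∀ t k {τ} → t ℕ.≤ 150 ℕ.* k → fromℕ k ≤ 12# * τ → fromℕ t ≤ timeConstant * τ
  scale-time t k {τ} t≤ k≤ = begin
    fromℕ t                ≤⟨ fromℕ-mono t≤ ⟩
    fromℕ (150 ℕ.* k)      ≡⟨ fromℕ-* 150 k ⟩
    fromℕ 150 * fromℕ k    ≤⟨ *-monoʳ-≤ (fromℕ-nonNeg 150) k≤ ⟩
    fromℕ 150 * (12# * τ)  ≡⟨ *-assoc (fromℕ 150) 12# τ ⟨
    timeConstant * τ       ∎
    where open ≤-Reasoning

  module _ {ε : Carrier} (0<ε : 0# < ε) (ε<1 : ε < 1#) {n b : ℕ} {Bs : Vec ℕ n} (Bs>0 : ∀ i → 0 ℕ.< lookup Bs i)
    {f : Vec ℕ n → Carrier} (f≥0 : NonNegative ℝ f) (mono : Monotone ℝ f) (dr : DRSubmodular ℝ f) where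

    open Hoare ℝ f using (Runs)
    open Verification ℝ f f≥0 mono dr b Bs Bs>0 ε 0<ε using (greedy-runs; greedyCost; itemsCost-total)

    outcome : ∀ d → fromℕ n ≤ ε * (1# + ε) ^ d → 1 ℕ.≤ weights Bs ⊎ d ≡ 0 →
      fromℕ (1 ℕ.+ (weights Bs ℕ.+ d ℕ.* weights Bs)) ≤ 12# * (1# + timeBound ℝ (size ℝ ε Bs) ε) →
      Outcome ε (suc b) Bs f
    outcome d suffices cases time = conclude (greedy-runs d suffices)
      where
      conclude : Runs greedy (initial ε (suc b) Bs) (λ s → Approximates ℝ ε (suc b) Bs f (output n s)) (greedyCost d) →
        Outcome ε (suc b) Bs f
      conclude (s , t , exec , t≤ , approx) = s , t , exec , approx ,
        scale-time t (1 ℕ.+ (weights Bs ℕ.+ d ℕ.* weights Bs)) (ℕ.≤-trans t≤ (greedy-time n (weights Bs) d (n≤weights Bs) cases itemsCost-total)) time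

  outcomes : ∀ {ε} → 0# < ε → ε < 1# → ∀ n b (Bs : Vec ℕ n) → (∀ i → 0 ℕ.< lookup Bs i) →
    ∀ f → NonNegative ℝ f → Monotone ℝ f → DRSubmodular ℝ f → Outcome ε (suc b) Bs f
  outcomes {ε} 0<ε ε<1 zero b [] Bs>0 f f≥0 mono dr =
    outcome 0<ε ε<1 Bs>0 f≥0 mono dr 0 (*-nonNeg (proj₁ 0<ε) 0≤1) (inj₂ refl)
      (≤-by (*-nonNeg (+-nonNeg 0≤1 (+-nonNeg 0≤2 (+-nonNeg 0≤2 (+-nonNeg 0≤2 (+-nonNeg 0≤2 0≤2))))) 0≤1)
        (solve 2 (λ i l → (1: :+ 2:) :* (2: :* 2:) :* (1: :+ (0: :* i :+ 0:) :* l :* i) :- (1: :+ 0:) :=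
            (1: :+ (2: :+ (2: :+ (2: :+ (2: :+ 2:))))) :* 1:) refl (ε ⁻¹) (log₂ (size ℝ ε [] ÷ ε))))
  outcomes 0<ε ε<1 (suc n) b Bs Bs>0 f f≥0 mono dr =
    outcome 0<ε ε<1 Bs>0 f≥0 mono dr (thresholds 0<ε ε<1 n Bs Bs>0) (thresholds-suffice 0<ε ε<1 n Bs Bs>0)
      (inj₁ (ℕ.s≤s ℕ.z≤n)) (time≤ 0<ε ε<1 n Bs Bs>0)

theorem6 : (ℝ : RealNumbers) → let open RealNumbers ℝ in let open Semantics ℝ in
    Σ[ algorithm ∈ Program ] Σ[ C ∈ Carrier ]
    (∀ (ε : Carrier) → 0# < ε → ε < 1# →
    ∀ (n B : ℕ) (Bs : Vec ℕ n) → 0 ℕ.< B → (∀ (i : Fin n) → 0 ℕ.< lookup Bs i) →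
    ∀ (f : Vec ℕ n → Carrier) → NonNegative ℝ f → Monotone ℝ f → DRSubmodular ℝ f →
    ∃[ s ] ∃[ t ]
    Exec f algorithm (initial ε B Bs) s t
    × Approximates ℝ ε B Bs f (output n s)
    × RunsInTime ℝ C ε Bs t)
theorem6 ℝ = greedy , timeConstant ℝ ,
  λ { ε 0<ε ε<1 n (suc b) Bs _ Bs>0 f f≥0 mono dr → outcomes ℝ 0<ε ε<1 n b Bs Bs>0 f f≥0 mono dr }
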